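{- Let $s\ge1$, $m\ge0$, $k\ge0$ be integers. Then $\sum_{\pi\in\mathrm{PF}(m,m+s-1)}\binom{\mathrm{disp}(\pi)}{k}$ equals the number of (simple) graphs with $m+k$ edges on $m+s$ labeled vertices which have exactly $s$ connected components, each containing exactly one of $s$ specified vertices.
   Context: For $0\le m\le n$, $\mathrm{PF}(m,n)$ is the set of sequences $\pi=(\pi_1,\dots,\pi_m)\in\{1,\dots,n\}^m$ such that, when spots $1,\dots,n$ are initially empty and for $i=1,\dots,m$ in turn car $i$ parks in the first empty spot among $\pi_i,\pi_i+1,\dots,n$, every car parks; if car $i$ parks in spot $\mathcal O(\pi)_i$, the displacement is $\mathrm{disp}(\pi)=\sum_i(\mathcal O(\pi)_i-\pi_i)$. -}

module Defs where

open import Data.Bool using (Bool; true; false; if_then_else_; _∧_)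
open import Data.Nat using (ℕ; zero; suc; _+_; _∸_; _≡ᵇ_; _<ᵇ_)
open import Data.Nat.Combinatorics using (_C_)
open import Data.Fin using (Fin; toℕ; _↑ˡ_)
open import Data.List using (List; []; _∷_; map; concatMap; length)
open import Data.Bool.ListAction using (any)
open import Data.Nat.ListAction using (sum)
open import Data.List.Membership.Propositional using (_∈_)
open import Data.List.Relation.Unary.Unique.Propositional using (Unique)
open import Data.Vec using (Vec; []; _∷_; lookup)
open import Data.Maybe using (Maybe; just; nothing)
open import Data.Product using (Σ; ∃; _×_)
open import Data.List using () renaming (allFin to allFinL)
open import Function.Bundles using (_⇔_)
open import Relation.Binary.PropositionalEquality using (_≡_)
open import Relation.Binary.Construct.Closure.ReflexiveTransitive using (Star)

-- Parking functions.  Spots are 0,…,n-1 (0-based); a preference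
-- sequence is an element of Vec (Fin n) m.  The shift from the paper's
-- 1-based convention does not change displacements.

firstEmpty : List ℕ → ℕ → ℕ → Maybe ℕ
firstEmpty occ p zero = nothing
firstEmpty occ p (suc fuel) =
  if any (λ q → q ≡ᵇ p) occ then firstEmpty occ (suc p) fuel else just p

parkFrom : (n : ℕ) → List ℕ → {m : ℕ} → Vec (Fin n) m → Maybe (List ℕ)
parkFrom n occ [] = just []
parkFrom n occ (p ∷ ps) with firstEmpty occ (toℕ p) (n ∸ toℕ p)
... | nothing = nothing
... | just o with parkFrom n (o ∷ occ) ps
...   | nothing = nothing
...   | just os = just (o ∷ os)

outcome : (n : ℕ) → {m : ℕ} → Vec (Fin n) m → Maybe (List ℕ)
outcome n π = parkFrom n [] π

IsPF : (n : ℕ) → {m : ℕ} → Vec (Fin n) m → Set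
IsPF n π = Σ (List ℕ) λ o → outcome n π ≡ just o

dispList : List ℕ → {m : ℕ} → Vec ℕ m → ℕ
dispList (o ∷ os) (p ∷ ps) = (o ∸ p) + dispList os ps
dispList _ _ = 0

toℕVec : {n m : ℕ} → Vec (Fin n) m → Vec ℕ m
toℕVec [] = []
toℕVec (p ∷ ps) = toℕ p ∷ toℕVec ps

allSeqs : (n m : ℕ) → List (Vec (Fin n) m)
allSeqs n zero = [] ∷ []
allSeqs n (suc m) = concatMap (λ i → map (i ∷_) (allSeqs n m)) (allFinL n)

pfBinomSum : (m n k : ℕ) → ℕ
pfBinomSum m n k = sum (map term (allSeqs n m))
  where
  term : Vec (Fin n) m → ℕ
  term π with outcome n π
  ... | nothing = 0
  ... | just o  = dispList o (toℕVec π) C k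

Graph : ℕ → Set
Graph V = Vec (Vec Bool V) V

entry : {V : ℕ} → Graph V → Fin V → Fin V → Bool
entry g i j = lookup (lookup g i) j

Adj : {V : ℕ} → Graph V → Fin V → Fin V → Set
Adj g i j = entry g i j ≡ true

IsSimple : {V : ℕ} → Graph V → Set
IsSimple {V} g = (∀ i → entry g i i ≡ false) × (∀ i j → entry g i j ≡ entry g j i)

edgeCount : {V : ℕ} → Graph V → ℕ
edgeCount {V} g =
  sum (concatMap (λ i → map (λ j → if (toℕ i <ᵇ toℕ j) ∧ entry g i j then 1 else 0)
                            (allFinL V)) (allFinL V))

Connected : {V : ℕ} → Graph V → Fin V → Fin V → Set
Connected g = Star (Adj g)

-- the s specified vertices are 0,…,s-1 of Fin (s + m)
root : {s m : ℕ} → Fin s → Fin (s + m)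
root {s} {m} a = a ↑ˡ m

-- exactly s connected components, each containing exactly one specified
-- vertex: the specified vertices are pairwise in different components
-- and every vertex lies in the component of some specified vertex.
ComponentCondition : (s m : ℕ) → Graph (s + m) → Set
ComponentCondition s m g =
  (∀ (a b : Fin s) → Connected g (root a) (root b) → a ≡ b) ×
  (∀ v → ∃ λ (a : Fin s) → Connected g (root a) v)

NumberOf : {A : Set} → (A → Set) → ℕ → Set
NumberOf {A} P N =
  Σ (List A) λ L → Unique L × (∀ x → (x ∈ L) ⇔ P x) × length L ≡ N

{-# OPTIONS --safe #-}

-- Both sides satisfy the recursion obtained by removing the last car,
-- respectively the last vertex v that is not specified.  With t specified
-- vertices and v unspecified, deleting the edges from v to the part of its
-- component that stays connected to the specified vertex r without v makes v
-- itself a specified vertex, the successor of r in a list R; the deleted edges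
-- are an arbitrary nonempty set S of vertices of the component of r, and
-- contribute |S| - 1 to the excess.  On the other side, just before the last
-- car parks there are t empty spots, separating runs of a - 1 occupied spots
-- each; the a preferences leading to the i-th spot have displacements
-- 0, …, a - 1.  The hockey-stick identity Σ_{e<a} (e C l) = a C (l + 1) matches
-- these with the sets S, where a is the size of the i-th component.  Since the
-- sizes change in the same way, the induction runs over weighted counts, with
-- an arbitrary weight depending on the list of sizes.
module Submission where

open import Defs
open import Data.Nat using (ℕ; _+_; _∸_; _≥_)
open import Data.Product using (_×_)
open import Relation.Binary.PropositionalEquality using (_≡_)
open import Algebra.Properties.CommutativeSemigroup using (interchange)
open import Data.Bool using (Bool; true; false; if_then_else_; _∧_; T)
open import Data.Bool.ListAction using (any)
import Data.Bool.Properties as Bool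
open import Data.Empty using (⊥-elim)
open import Data.Fin using (Fin; toℕ; _≟_; _↑ˡ_; _↑ʳ_; splitAt)
open import Data.Fin.Properties
  using (toℕ-injective; ↑ˡ-injective; ↑ʳ-injective; splitAt-↑ˡ; splitAt-↑ʳ; splitAt⁻¹-↑ˡ; splitAt⁻¹-↑ʳ)
open import Data.List
  using (List; []; _∷_; _++_; map; concatMap; filter; length; upTo; applyUpTo; downFrom; allFin; tabulate;
         replicate)
open import Data.List.Membership.Propositional using (_∈_; _∉_; find; lose)
open import Data.List.Membership.Propositional.Properties
  using (∈-map⁺; ∈-map⁻; ∈-++⁺ˡ; ∈-++⁺ʳ; ∈-++⁻; ∈-∃++; ∈-concatMap⁺; ∈-concatMap⁻; ∈-filter⁺; ∈-filter⁻;
         ∈-allFin; ∈-applyUpTo⁻)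
open import Data.List.Properties
  using (map-++; map-∘; map-cong-local; map-upTo; map-applyUpTo; map-tabulate; length-map; length-tabulate;
         length-replicate; length-++-sucʳ; ++-assoc; filter-accept; filter-reject; filter-none; filter-≐)
open import Data.List.Relation.Binary.Permutation.Propositional using (_↭_; ↭-sym; ↭-reflexive; ↭-trans; ↭⇒↭ₛ)
open import Data.List.Relation.Binary.Permutation.Propositional.Properties using (shift; ∈-resp-↭; ↭-length)
import Data.List.Relation.Binary.Permutation.Setoid.Properties as Permutation
open import Data.List.Relation.Unary.All as All using (All; []; _∷_)
import Data.List.Relation.Unary.All.Properties as All
open import Data.List.Relation.Unary.AllPairs as AllPairs using (AllPairs; []; _∷_)
import Data.List.Relation.Unary.AllPairs.Properties as AllPairs
open import Data.List.Relation.Unary.Any using (Any; here; there; any?)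
open import Data.List.Relation.Unary.Unique.Propositional using (Unique)
import Data.List.Relation.Unary.Unique.Propositional.Properties as Unique
open import Data.Maybe using (Maybe; just; nothing; maybe′)
open import Data.Nat using (zero; suc; pred; _≤_; _<_; s≤s; z<s; s<s; s≤s⁻¹; _≡ᵇ_; _<ᵇ_)
open import Data.Nat.Combinatorics using (_C_; nCk+nC[k+1]≡[n+1]C[k+1])
open import Data.Nat.ListAction using (sum)
open import Data.Nat.ListAction.Properties using (sum-++)
open import Data.Nat.Properties
  using (+-assoc; +-cancelˡ-<; +-cancelˡ-≡; +-comm; +-commutativeSemigroup; +-identityʳ; +-monoʳ-<;
         +-monoʳ-≤; +-suc; <-asym; <-cmp; <-≤-trans; <ᵇ⇒<; <⇒<ᵇ; <⇒≢; <⇒≤; [m+n]∸[m+o]≡n∸o; m+[n∸m]≡n;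
         m+n∸m≡n; m<n⇒m<1+n; m≤m+n; m≤n⇒m≤1+n; suc-injective; ∸-monoˡ-<; ≡ᵇ⇒≡; ≤-refl; ≤-reflexive;
         ≤-trans) renaming (_≟_ to _≟ℕ_)
open import Data.Product using (∃; ∃₂; _,_; proj₁; proj₂)
open import Data.Sum using (_⊎_; inj₁; inj₂; [_,_]′)
open import Data.Vec using (Vec; []; _∷_; lookup)
open import Data.Vec.Properties using (lookup-replicate; lookup∘tabulate; tabulate∘lookup; tabulate-cong)
import Data.Vec as Vec
open import Function using (_∘_; id; const)
open import Function.Bundles using (mk⇔)
open import Level using (0ℓ)
open import Relation.Binary.Construct.Closure.ReflexiveTransitive using (Star; ε; _◅_; _◅◅_; gmap)
open import Relation.Binary.Definitions using (tri<; tri≈; tri>)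
open import Relation.Binary.PropositionalEquality
  using (_≢_; refl; sym; trans; cong; cong₂; cong-app; subst; setoid; module ≡-Reasoning)
open import Relation.Nullary using (¬_; Dec; yes; no; does; contradiction; _×-dec_; _⊎-dec_; ¬?)
open import Relation.Nullary.Decidable using (dec-true; dec-false)
open import Relation.Unary using (Pred; Decidable)

open ≡-Reasoning

-- The identity carried through the induction is: the sum of ψ(sizes, excess) over the rooted graphs
-- equals the sum of Σₖ (disp C k) ψ(sizes, k) over the parking sequences, for every weight ψ. The
-- theorem is the case where ψ is the indicator of one excess. The binomial transform is compatible
-- with a single step because displacements add and Vandermonde's convolution separates the last car
-- from the earlier ones. The weight has to be arbitrary because the contribution of the last step
-- depends on the sizes before it; this contribution is absorbed into the weight, and only then is
-- the induction hypothesis applied.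
--
-- The starting points agree: m + s singleton components correspond to the m + s empty runs around m
-- + s - 1 empty spots. Parking a car and attaching a vertex both replace two neighbouring sizes by
-- their sum. This is why the roots form an ordered list with v directly behind r: the position of r
-- alone then tells which two sizes are added, as the position of an empty spot does.

private
  variable
    A A′ K K′ : Set

-- Finite sums over lists.

∑ : List A → (A → ℕ) → ℕ
∑ xs f = sum (map f xs)

∑-cong-∈ : (xs : List A) {f g : A → ℕ} → (∀ {x} → x ∈ xs → f x ≡ g x) → ∑ xs f ≡ ∑ xs g
∑-cong-∈ []       eq = refl
∑-cong-∈ (x ∷ xs) eq = cong₂ _+_ (eq (here refl)) (∑-cong-∈ xs (eq ∘ there))

∑-cong : (xs : List A) {f g : A → ℕ} → (∀ x → f x ≡ g x) → ∑ xs f ≡ ∑ xs g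
∑-cong xs eq = ∑-cong-∈ xs (λ {x} _ → eq x)

∑-++ : (xs ys : List A) (f : A → ℕ) → ∑ (xs ++ ys) f ≡ ∑ xs f + ∑ ys f
∑-++ xs ys f = trans (cong sum (map-++ f xs ys)) (sum-++ (map f xs) (map f ys))

∑-map : (h : A → A′) (xs : List A) (f : A′ → ℕ) → ∑ (map h xs) f ≡ ∑ xs (f ∘ h)
∑-map h xs f = cong sum (sym (map-∘ xs))

∑-concatMap : (h : A → List A′) (xs : List A) (f : A′ → ℕ) →
              ∑ (concatMap h xs) f ≡ ∑ xs (λ x → ∑ (h x) f)
∑-concatMap h []       f = refl
∑-concatMap h (x ∷ xs) f = trans (∑-++ (h x) (concatMap h xs) f) (cong (∑ (h x) f +_) (∑-concatMap h xs f))

∑-+ : (xs : List A) (f g : A → ℕ) → ∑ xs (λ x → f x + g x) ≡ ∑ xs f + ∑ xs g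
∑-+ []       f g = refl
∑-+ (x ∷ xs) f g = trans (cong (f x + g x +_) (∑-+ xs f g))
                         (interchange +-commutativeSemigroup (f x) (g x) (∑ xs f) (∑ xs g))

∑-zero : (xs : List A) → ∑ xs (const 0) ≡ 0
∑-zero []       = refl
∑-zero (x ∷ xs) = ∑-zero xs

∑-swap : (xs : List A) (ys : List A′) (f : A → A′ → ℕ) →
         ∑ xs (λ x → ∑ ys (f x)) ≡ ∑ ys (λ y → ∑ xs (λ x → f x y))
∑-swap []       ys f = sym (∑-zero ys)
∑-swap (x ∷ xs) ys f = trans (cong (∑ ys (f x) +_) (∑-swap xs ys f))
                             (sym (∑-+ ys (f x) (λ y → ∑ xs (λ x′ → f x′ y))))

∑-upTo-suc : ∀ n (f : ℕ → ℕ) → ∑ (upTo (suc n)) f ≡ f 0 + ∑ (upTo n) (f ∘ suc)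
∑-upTo-suc n f = cong (λ l → f 0 + sum l) (trans (map-applyUpTo suc f n) (sym (map-upTo (f ∘ suc) n)))

∑-upTo-+ : ∀ a b (f : ℕ → ℕ) → ∑ (upTo (a + b)) f ≡ ∑ (upTo a) f + ∑ (upTo b) (λ j → f (a + j))
∑-upTo-+ zero    b f = refl
∑-upTo-+ (suc a) b f = begin
  ∑ (upTo (suc a + b)) f                                            ≡⟨ ∑-upTo-suc (a + b) f ⟩
  f 0 + ∑ (upTo (a + b)) (f ∘ suc)                                  ≡⟨ cong (f 0 +_) (∑-upTo-+ a b (f ∘ suc)) ⟩
  f 0 + (∑ (upTo a) (f ∘ suc) + ∑ (upTo b) (λ j → f (suc a + j)))   ≡⟨ +-assoc (f 0) _ _ ⟨
  f 0 + ∑ (upTo a) (f ∘ suc) + ∑ (upTo b) (λ j → f (suc a + j))     ≡⟨ cong (_+ ∑ (upTo b) (λ j → f (suc a + j))) (∑-upTo-suc a f) ⟨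
  ∑ (upTo (suc a)) f + ∑ (upTo b) (λ j → f (suc a + j))             ∎

∑-upTo-reverse : ∀ a (f : ℕ → ℕ) → ∑ (upTo (suc a)) (λ j → f (a ∸ j)) ≡ ∑ (downFrom (suc a)) f
∑-upTo-reverse zero    f = refl
∑-upTo-reverse (suc a) f = trans (∑-upTo-suc (suc a) (λ j → f (suc a ∸ j))) (cong (f (suc a) +_) (∑-upTo-reverse a f))

tabulate-toℕ : ∀ n (f : ℕ → A) → tabulate {n = n} (f ∘ toℕ) ≡ applyUpTo f n
tabulate-toℕ zero    f = refl
tabulate-toℕ (suc n) f = cong (f 0 ∷_) (tabulate-toℕ n (f ∘ suc))

∑-allFin-toℕ : ∀ n (f : ℕ → ℕ) → ∑ (allFin n) (f ∘ toℕ) ≡ ∑ (upTo n) f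
∑-allFin-toℕ n f = cong sum (trans (map-tabulate id (f ∘ toℕ)) (trans (tabulate-toℕ n f) (sym (map-upTo f n))))

-- binomial d g = Σₖ (d C k) g(k)
binomial : ℕ → (ℕ → ℕ) → ℕ
binomial zero    g = g 0
binomial (suc d) g = binomial d g + binomial d (g ∘ suc)

-- Vandermonde's convolution: a subset of d + e elements splits into a part of the first d and a
-- part of the last e.
binomial-+ : ∀ d e (g : ℕ → ℕ) → binomial (d + e) g ≡ binomial d (λ k → binomial e (λ l → g (k + l)))
binomial-+ zero    e g = refl
binomial-+ (suc d) e g = cong₂ _+_ (binomial-+ d e g) (binomial-+ d e (g ∘ suc))

binomial-∑ : ∀ d (xs : List A) (f : A → ℕ → ℕ) →
             binomial d (λ k → ∑ xs (λ x → f x k)) ≡ ∑ xs (λ x → binomial d (f x))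
binomial-∑ zero    xs f = refl
binomial-∑ (suc d) xs f = trans (cong₂ _+_ (binomial-∑ d xs f) (binomial-∑ d xs (λ x → f x ∘ suc)))
                                (sym (∑-+ xs _ _))

indicator : ℕ → ℕ → ℕ
indicator k j = if j ≡ᵇ k then 1 else 0

binomial-zero : ∀ d → binomial d (const 0) ≡ 0
binomial-zero zero    = refl
binomial-zero (suc d) = cong₂ _+_ (binomial-zero d) (binomial-zero d)

binomial-indicator : ∀ d k → binomial d (indicator k) ≡ d C k
binomial-indicator zero    zero    = refl
binomial-indicator zero    (suc k) = refl
binomial-indicator (suc d) zero    = cong₂ _+_ (binomial-indicator d 0) (binomial-zero d)
binomial-indicator (suc d) (suc k) = begin
  binomial d (indicator (suc k)) + binomial d (indicator k)
    ≡⟨ cong₂ _+_ (binomial-indicator d (suc k)) (binomial-indicator d k) ⟩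
  d C suc k + d C k  ≡⟨ +-comm (d C suc k) (d C k) ⟩
  d C k + d C suc k  ≡⟨ nCk+nC[k+1]≡[n+1]C[k+1] d k ⟩
  suc d C suc k      ∎

-- Parking

-- A configuration of t empty spots is the list of the t + 1 lengths, each
-- increased by one, of the maximal (possibly empty) runs of occupied spots
-- between them.  Parking in the i-th empty spot merges runs i and i + 1.

Configuration : Set
Configuration = List ℕ

sizeAt : ℕ → Configuration → ℕ
sizeAt _       []      = 0
sizeAt zero    (a ∷ _) = a
sizeAt (suc i) (_ ∷ c) = sizeAt i c

mergeAt : ℕ → Configuration → Configuration
mergeAt zero    (a ∷ b ∷ c) = a + b ∷ c
mergeAt zero    c           = c
mergeAt (suc i) []          = []
mergeAt (suc i) (a ∷ c)     = a ∷ mergeAt i c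

-- The second argument is a displacement on the parking side and an excess on the graph side.
Weight : Set
Weight = Configuration → ℕ → ℕ

-- There are t + 1 runs but only t empty spots: a preference in the last run leaves the car unparked
-- and contributes nothing.
parkOne : ℕ → Weight → Weight
parkOne t ψ c d = ∑ (upTo t) (λ i → ∑ (downFrom (sizeAt i c)) (λ e → ψ (mergeAt i c) (d + e)))

-- t is the number of empty spots before the last of the m cars parks.
park : (m t : ℕ) → Weight → Weight
park zero    t ψ = ψ
park (suc m) t ψ = parkOne (m + t) (park m t ψ)

-- `park` unfolds from the first car, while the induction on graphs removes the last one; this
-- passes between the two.
park-last : ∀ m t ψ → park m (suc t) (parkOne t ψ) ≡ park (suc m) t ψ
park-last zero    t ψ = refl
park-last (suc m) t ψ = cong₂ parkOne (+-suc m t) (park-last m t ψ)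

park-cong : ∀ m t {φ ψ : Weight} → (∀ c d → φ c d ≡ ψ c d) → ∀ c d → park m t φ c d ≡ park m t ψ c d
park-cong zero    t eq c d = eq c d
park-cong (suc m) t eq c d = ∑-cong (upTo (m + t)) λ i → ∑-cong (downFrom (sizeAt i c)) λ e →
  park-cong m t eq (mergeAt i c) (d + e)

-- Linearity in the weight: the sum over the root to which the removed vertex is attached moves
-- inside and becomes the sum over the spot of the last car.
park-∑ : ∀ m t (xs : List A) (φ : A → Weight) c d →
         ∑ xs (λ x → park m t (φ x) c d) ≡ park m t (λ c′ d′ → ∑ xs (λ x → φ x c′ d′)) c d
park-∑ zero    t xs φ c d = refl
park-∑ (suc m) t xs φ c d = begin
  ∑ xs (λ x → ∑ (upTo (m + t)) (λ i → ∑ (downFrom (sizeAt i c)) (λ e → park m t (φ x) (mergeAt i c) (d + e))))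
    ≡⟨ ∑-swap xs (upTo (m + t)) _ ⟩
  ∑ (upTo (m + t)) (λ i → ∑ xs (λ x → ∑ (downFrom (sizeAt i c)) (λ e → park m t (φ x) (mergeAt i c) (d + e))))
    ≡⟨ (∑-cong (upTo (m + t)) λ i → trans (∑-swap xs (downFrom (sizeAt i c)) _)
         (∑-cong (downFrom (sizeAt i c)) λ e → park-∑ m t xs φ (mergeAt i c) (d + e))) ⟩
  park (suc m) t (λ c′ d′ → ∑ xs (λ x → φ x c′ d′)) c d ∎

-- First empty spots and runs of occupied spots.

taken : List ℕ → ℕ → Bool
taken occ p = any (λ q → q ≡ᵇ p) occ

≡ᵇ-refl : ∀ n → (n ≡ᵇ n) ≡ true
≡ᵇ-refl zero    = refl
≡ᵇ-refl (suc n) = ≡ᵇ-refl n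

<⇒≢ᵇ : ∀ {m n} → m < n → (m ≡ᵇ n) ≡ false
<⇒≢ᵇ {zero}  {suc n} _         = refl
<⇒≢ᵇ {suc m} {suc n} (s≤s m<n) = <⇒≢ᵇ m<n

taken-here : ∀ o occ → taken (o ∷ occ) o ≡ true
taken-here o occ rewrite ≡ᵇ-refl o = refl

taken-there : ∀ o occ {p} → taken occ p ≡ true → taken (o ∷ occ) p ≡ true
taken-there o occ {p} eq with o ≡ᵇ p
... | true  = refl
... | false = eq

free-there : ∀ {o} occ {p} → o < p → taken occ p ≡ false → taken (o ∷ occ) p ≡ false
free-there {o} occ {p} o<p eq rewrite <⇒≢ᵇ o<p = eq

firstEmpty-just : ∀ occ d p fuel → (∀ j → j < d → taken occ (p + j) ≡ true) → taken occ (p + d) ≡ false →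
                  d < fuel → firstEmpty occ p fuel ≡ just (p + d)
firstEmpty-just occ zero p (suc fuel) _ free _ rewrite +-identityʳ p | free = refl
firstEmpty-just occ (suc d) p (suc fuel) block free (s≤s d<fuel)
  rewrite trans (cong (taken occ) (sym (+-identityʳ p))) (block 0 z<s) =
  trans (firstEmpty-just occ d (suc p) fuel
          (λ j j<d → trans (cong (taken occ) (sym (+-suc p j))) (block (suc j) (s<s j<d)))
          (trans (cong (taken occ) (sym (+-suc p d))) free) d<fuel)
        (cong just (sym (+-suc p d)))

firstEmpty-nothing : ∀ occ fuel p → (∀ j → j < fuel → taken occ (p + j) ≡ true) →
                     firstEmpty occ p fuel ≡ nothing
firstEmpty-nothing occ zero       p block = refl
firstEmpty-nothing occ (suc fuel) p block
  rewrite trans (cong (taken occ) (sym (+-identityʳ p))) (block 0 z<s) =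
  firstEmpty-nothing occ fuel (suc p) λ j j<f → trans (cong (taken occ) (sym (+-suc p j))) (block (suc j) (s<s j<f))

Block : List ℕ → ℕ → ℕ → Set
Block occ p a = ∀ j → j < a → taken occ (p + j) ≡ true

-- Reads off the configuration of `occ` from position `p` on. Only `next` demands a free spot behind
-- its block, since the last block stops at the end of the street.
data Segments (occ : List ℕ) (p : ℕ) : Configuration → Set where
  final : ∀ {a} → Block occ p a → Segments occ p (suc a ∷ [])
  next  : ∀ {a c} → Block occ p a → taken occ (p + a) ≡ false → Segments occ (suc (p + a)) c →
          Segments occ p (suc a ∷ c)

-- The position of the i-th empty spot on the street; `pred` undoes the increment built into the
-- sizes.
gapAt : ℕ → ℕ → Configuration → ℕ
gapAt p _       []      = p
gapAt p zero    (a ∷ _) = p + pred a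
gapAt p (suc i) (a ∷ c) = gapAt (suc (p + pred a)) i c

gapAt-≥ : ∀ p i c → p ≤ gapAt p i c
gapAt-≥ p i       []      = ≤-refl
gapAt-≥ p zero    (a ∷ c) = m≤m+n p (pred a)
gapAt-≥ p (suc i) (a ∷ c) = ≤-trans (m≤n⇒m≤1+n (m≤m+n p (pred a))) (gapAt-≥ (suc (p + pred a)) i c)

sum-suc : ∀ {occ p c} → Segments occ p c → sum c ≡ suc (pred (sum c))
sum-suc (final _)    = refl
sum-suc (next _ _ _) = refl

length-suc : ∀ {occ p c} → Segments occ p c → length c ≡ suc (pred (length c))
length-suc (final _)    = refl
length-suc (next _ _ _) = refl

Block-there : ∀ o occ {p a} → Block occ p a → Block (o ∷ occ) p a
Block-there o occ block j j<a = taken-there o occ (block j j<a)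

Segments-there : ∀ o {occ p c} → o < p → Segments occ p c → Segments (o ∷ occ) p c
Segments-there o {occ} o<p (final block) = final (Block-there o occ block)
Segments-there o {occ} {p} o<p (next {a} block free segs) =
  next (Block-there o occ block) (free-there occ (<-≤-trans o<p (m≤m+n p a)) free)
       (Segments-there o (m<n⇒m<1+n (<-≤-trans o<p (m≤m+n p a))) segs)

-- The merged run consists of the left run, the new car and the right run. Its length `a + suc b`
-- makes the incremented sizes additive: `suc a + suc b`.
Block-merge : ∀ occ p a b → Block occ p a → Block occ (suc (p + a)) b → Block (p + a ∷ occ) p (a + suc b)
Block-merge occ p a b left right j j<a+b with <-cmp j a
... | tri< j<a _ _ = taken-there (p + a) occ (left j j<a)
... | tri≈ _ refl _ = taken-here (p + a) occ
... | tri> _ _ a<j = taken-there (p + a) occ (subst (λ q → taken occ q ≡ true) offset (right (j ∸ suc a)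
        (+-cancelˡ-< (suc a) _ _ (subst (_< suc a + b) (sym (m+[n∸m]≡n a<j)) (subst (j <_) (+-suc a b) j<a+b)))))
  where
  offset : suc (p + a) + (j ∸ suc a) ≡ p + j
  offset = begin
    suc (p + a) + (j ∸ suc a)  ≡⟨ cong (_+ (j ∸ suc a)) (+-suc p a) ⟨
    p + suc a + (j ∸ suc a)    ≡⟨ +-assoc p (suc a) _ ⟩
    p + (suc a + (j ∸ suc a))  ≡⟨ cong (p +_) (m+[n∸m]≡n a<j) ⟩
    p + j                      ∎

Segments-merge : ∀ {occ p c} i → i < pred (length c) → Segments occ p c →
                 Segments (gapAt p i c ∷ occ) p (mergeAt i c)
Segments-merge {occ} {p} zero _ (next {a} left _ (final {b} right)) = final (Block-merge occ p a b left right)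
Segments-merge {occ} {p} zero _ (next {a} left _ (next {b} {c} right free segs)) =
  next (Block-merge occ p a b left right)
       (subst (λ q → taken (p + a ∷ occ) q ≡ false) (sym p+[a+1+b]) (free-there occ (s≤s (m≤m+n (p + a) b)) free))
       (subst (λ q → Segments (p + a ∷ occ) (suc q) c) (sym p+[a+1+b])
         (Segments-there (p + a) (s≤s (m≤n⇒m≤1+n (m≤m+n (p + a) b))) segs))
  where
  p+[a+1+b] : p + (a + suc b) ≡ suc (p + a) + b
  p+[a+1+b] = trans (sym (+-assoc p a (suc b))) (+-suc (p + a) b)
Segments-merge {occ} {p} (suc i) i<l (next {a} {c} block free segs) =
  next (Block-there (gapAt (suc (p + a)) i c) occ block) (free′ (gapAt-≥ (suc (p + a)) i c))
       (Segments-merge i (s≤s⁻¹ (subst (suc i <_) (length-suc segs) i<l)) segs)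
  where
  free′ : ∀ {o} → p + a < o → taken (o ∷ occ) (p + a) ≡ false
  free′ {o} p+a<o with o ≡ᵇ (p + a) in eq
  ... | true  = contradiction (sym (≡ᵇ⇒≡ o (p + a) (subst T (sym eq) _))) (<⇒≢ p+a<o)
  ... | false = free

module _ (occ : List ℕ) (n : ℕ) (H : ℕ → ℕ → ℕ) where

  -- `H o e` stands for the total over the later cars once the present one has parked in spot `o`
  -- with displacement `e`. Keeping it abstract separates the grouping of preferences from the
  -- recursion over cars.
  parkedAt : ℕ → ℕ
  parkedAt p = maybe′ (λ o → H o (o ∸ p)) 0 (firstEmpty occ p (n ∸ p))

  ∑-block : ∀ p a → Block occ p a → taken occ (p + a) ≡ false → p + a < n →
            ∑ (upTo (suc a)) (λ j → parkedAt (p + j)) ≡ ∑ (downFrom (suc a)) (H (p + a))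
  ∑-block p a block free p+a<n = trans (∑-cong-∈ (upTo (suc a)) step) (∑-upTo-reverse a (H (p + a)))
    where
    parked : ∀ j → j ≤ a → parkedAt (p + j) ≡ H (p + a) (a ∸ j)
    parked j j≤a = begin
      parkedAt (p + j)
        ≡⟨ cong (maybe′ (λ o → H o (o ∸ (p + j))) 0) (firstEmpty-just occ (a ∸ j) (p + j) (n ∸ (p + j))
             (λ i i<a∸j → trans (cong (taken occ) (+-assoc p j i))
               (block (j + i) (subst (j + i <_) (m+[n∸m]≡n j≤a) (+-monoʳ-< j i<a∸j))))
             (trans (cong (taken occ) to-gap) free)
             (subst (_< n ∸ (p + j)) ([m+n]∸[m+o]≡n∸o p a j) (∸-monoˡ-< p+a<n (+-monoʳ-≤ p j≤a)))) ⟩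
      H (p + j + (a ∸ j)) (p + j + (a ∸ j) ∸ (p + j))
        ≡⟨ cong₂ H to-gap (m+n∸m≡n (p + j) (a ∸ j)) ⟩
      H (p + a) (a ∸ j) ∎
      where
      to-gap : p + j + (a ∸ j) ≡ p + a
      to-gap = trans (+-assoc p j (a ∸ j)) (cong (p +_) (m+[n∸m]≡n j≤a))
    step : ∀ {j} → j ∈ upTo (suc a) → parkedAt (p + j) ≡ H (p + a) (a ∸ j)
    step j∈ with i , i<1+a , refl ← ∈-applyUpTo⁻ id j∈ = parked i (s≤s⁻¹ i<1+a)

  -- Preferences are grouped by the empty spot they lead to, and those in the last run overflow.
  -- Each size counts its run and the empty spot behind it, except that nothing lies behind the last
  -- run; hence `suc n`, and `pred (sum c)` for the number of spots from `p` on.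
  ∑-parked : ∀ {p c} → Segments occ p c → suc n ≡ p + sum c →
             ∑ (upTo (pred (sum c))) (λ j → parkedAt (p + j)) ≡
             ∑ (upTo (pred (length c))) (λ i → ∑ (downFrom (sizeAt i c)) (H (gapAt p i c)))
  ∑-parked {p} (final {a} block) n≡ = trans (∑-cong-∈ (upTo (a + 0)) overflow) (∑-zero (upTo (a + 0)))
    where
    n≡p+a : n ≡ p + a
    n≡p+a = suc-injective (trans n≡ (trans (cong (λ b → p + suc b) (+-identityʳ a)) (+-suc p a)))
    overflow : ∀ {j} → j ∈ upTo (a + 0) → parkedAt (p + j) ≡ 0
    overflow {j} j∈ with i , i<a , refl ← ∈-applyUpTo⁻ id j∈ =
      cong (maybe′ (λ o → H o (o ∸ (p + i))) 0) (firstEmpty-nothing occ (n ∸ (p + i)) (p + i)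
        λ l l< → trans (cong (taken occ) (+-assoc p i l))
          (block (i + l) (<-≤-trans (+-monoʳ-< i (subst (l <_) (trans (cong (_∸ (p + i)) n≡p+a) ([m+n]∸[m+o]≡n∸o p a i)) l<))
                                    (≤-reflexive (m+[n∸m]≡n (<⇒≤ (subst (i <_) (+-identityʳ a) i<a)))))))
  ∑-parked {p} (next {a} {c} block free segs) n≡ = begin
    ∑ (upTo (a + sum c)) (λ j → parkedAt (p + j))
      ≡⟨ cong (λ l → ∑ (upTo l) (λ j → parkedAt (p + j))) (trans (cong (a +_) (sum-suc segs)) (+-suc a (pred (sum c)))) ⟩
    ∑ (upTo (suc a + pred (sum c))) (λ j → parkedAt (p + j))
      ≡⟨ ∑-upTo-+ (suc a) (pred (sum c)) (λ j → parkedAt (p + j)) ⟩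
    ∑ (upTo (suc a)) (λ j → parkedAt (p + j)) + ∑ (upTo (pred (sum c))) (λ j → parkedAt (p + (suc a + j)))
      ≡⟨ cong₂ _+_ (∑-block p a block free p+a<n)
           (trans (∑-cong (upTo (pred (sum c))) λ j → cong parkedAt (offset j))
             (∑-parked segs (trans n≡ (offset (sum c))))) ⟩
    ∑ (downFrom (suc a)) (H (p + a)) +
      ∑ (upTo (pred (length c))) (λ i → ∑ (downFrom (sizeAt i c)) (H (gapAt (suc (p + a)) i c)))
      ≡⟨ ∑-upTo-suc (pred (length c)) (λ i → ∑ (downFrom (sizeAt i (suc a ∷ c))) (H (gapAt p i (suc a ∷ c)))) ⟨
    ∑ (upTo (suc (pred (length c)))) (λ i → ∑ (downFrom (sizeAt i (suc a ∷ c))) (H (gapAt p i (suc a ∷ c))))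
      ≡⟨ cong (λ l → ∑ (upTo l) (λ i → ∑ (downFrom (sizeAt i (suc a ∷ c))) (H (gapAt p i (suc a ∷ c))))) (length-suc segs) ⟨
    ∑ (upTo (length c)) (λ i → ∑ (downFrom (sizeAt i (suc a ∷ c))) (H (gapAt p i (suc a ∷ c)))) ∎
    where
    offset : ∀ j → p + (suc a + j) ≡ suc (p + a) + j
    offset j = trans (sym (+-assoc p (suc a) j)) (cong (_+ j) (+-suc p a))
    -- Another run follows, and its size is at least 1, so the free spot still lies on the street.
    p+a<n : p + a < n
    p+a<n = s≤s⁻¹ (subst (suc (suc (p + a)) ≤_)
      (sym (trans n≡ (trans (offset (sum c)) (trans (cong (suc (p + a) +_) (sum-suc segs)) (+-suc (suc (p + a)) _)))))
      (s≤s (m≤m+n (suc (p + a)) (pred (sum c)))))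

module _ (n k : ℕ) where

  -- `d` accumulates the displacement of the cars already parked, because `_C k` is applied to the
  -- total and is not additive.
  dispC : ℕ → ∀ {m} → Vec (Fin n) m → Maybe (List ℕ) → ℕ
  dispC d π = maybe′ (λ o → (d + dispList o (toℕVec π)) C k) 0

  dispC-∷ : ∀ occ d {m} (p : Fin n) (π : Vec (Fin n) m) →
            dispC d (p ∷ π) (parkFrom n occ (p ∷ π)) ≡
            maybe′ (λ o → dispC (d + (o ∸ toℕ p)) π (parkFrom n (o ∷ occ) π)) 0 (firstEmpty occ (toℕ p) (n ∸ toℕ p))
  dispC-∷ occ d p π with firstEmpty occ (toℕ p) (n ∸ toℕ p)
  ... | nothing = refl
  ... | just o with parkFrom n (o ∷ occ) π
  ...   | nothing = refl
  ...   | just os = cong (_C k) (sym (+-assoc d (o ∸ toℕ p) (dispList os (toℕVec π))))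

  ∑-maybe : (xs : List A) (mo : Maybe ℕ) (f : A → ℕ → ℕ) →
            ∑ xs (λ x → maybe′ (f x) 0 mo) ≡ maybe′ (λ o → ∑ xs (λ x → f x o)) 0 mo
  ∑-maybe xs nothing  f = ∑-zero xs
  ∑-maybe xs (just o) f = refl

  sum-mergeAt : ∀ i c → sum (mergeAt i c) ≡ sum c
  sum-mergeAt zero    []          = refl
  sum-mergeAt zero    (a ∷ [])    = refl
  sum-mergeAt zero    (a ∷ b ∷ c) = +-assoc a b (sum c)
  sum-mergeAt (suc i) []          = refl
  sum-mergeAt (suc i) (a ∷ c)     = cong (a +_) (sum-mergeAt i c)

  length-mergeAt : ∀ i c → i < pred (length c) → suc (length (mergeAt i c)) ≡ length c
  length-mergeAt zero    (a ∷ b ∷ c) _         = refl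
  length-mergeAt (suc i) (a ∷ b ∷ c) (s≤s i<l) = cong suc (length-mergeAt i (b ∷ c) i<l)

  -- Peels off the first car: `∑-parked` groups its preferences, and `Segments-merge` gives the
  -- configuration that the later cars meet. As each car merges two runs, `t` is also the number of
  -- runs at the end.
  ∑-parkFrom : ∀ m t occ c d → Segments occ 0 c → sum c ≡ suc n → length c ≡ m + t →
               ∑ (allSeqs n m) (λ π → dispC d π (parkFrom n occ π)) ≡ park m t (λ _ d′ → d′ C k) c d
  ∑-parkFrom zero    t occ c d segs sum≡ len≡ = trans (+-identityʳ _) (cong (_C k) (+-identityʳ d))
  ∑-parkFrom (suc m) t occ c d segs sum≡ len≡ = begin
    ∑ (allSeqs n (suc m)) (λ π → dispC d π (parkFrom n occ π))
      ≡⟨ ∑-concatMap (λ p → map (p ∷_) (allSeqs n m)) (allFin n) _ ⟩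
    ∑ (allFin n) (λ p → ∑ (map (p ∷_) (allSeqs n m)) (λ π → dispC d π (parkFrom n occ π)))
      ≡⟨ (∑-cong (allFin n) λ p → trans (∑-map (p ∷_) (allSeqs n m) _)
           (trans (∑-cong (allSeqs n m) (dispC-∷ occ d p)) (∑-maybe (allSeqs n m) (firstEmpty occ (toℕ p) (n ∸ toℕ p)) _))) ⟩
    ∑ (allFin n) (λ p → parkedAt occ n H (toℕ p))
      ≡⟨ ∑-allFin-toℕ n (parkedAt occ n H) ⟩
    ∑ (upTo n) (parkedAt occ n H)
      ≡⟨ cong (λ l → ∑ (upTo l) (parkedAt occ n H)) (cong pred sum≡) ⟨
    ∑ (upTo (pred (sum c))) (parkedAt occ n H)
      ≡⟨ ∑-parked occ n H segs (sym sum≡) ⟩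
    ∑ (upTo (pred (length c))) (λ i → ∑ (downFrom (sizeAt i c)) (H (gapAt 0 i c)))
      ≡⟨ (∑-cong-∈ (upTo (pred (length c))) λ i∈ → inner (∈-applyUpTo⁻ id i∈)) ⟩
    ∑ (upTo (pred (length c))) F
      ≡⟨ cong (λ l → ∑ (upTo (pred l)) F) len≡ ⟩
    park (suc m) t (λ _ d′ → d′ C k) c d ∎
    where
    H : ℕ → ℕ → ℕ
    H o e = ∑ (allSeqs n m) (λ π → dispC (d + e) π (parkFrom n (o ∷ occ) π))
    F : ℕ → ℕ
    F i = ∑ (downFrom (sizeAt i c)) (λ e → park m t (λ _ d′ → d′ C k) (mergeAt i c) (d + e))
    inner : ∀ {i} → (∃ λ j → j < pred (length c) × i ≡ j) → ∑ (downFrom (sizeAt i c)) (H (gapAt 0 i c)) ≡ F i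
    inner {i} (_ , i<l , refl) = ∑-cong (downFrom (sizeAt i c)) λ e →
      ∑-parkFrom m t (gapAt 0 i c ∷ occ) (mergeAt i c) (d + e) (Segments-merge i i<l segs)
        (trans (sum-mergeAt i c) sum≡)
        (suc-injective (trans (length-mergeAt i c i<l) len≡))

Segments-empty : ∀ l p → Segments [] p (replicate (suc l) 1)
Segments-empty zero    p = final λ _ ()
Segments-empty (suc l) p = next (λ _ ()) refl (Segments-empty l (suc (p + 0)))

sum-replicate-1 : ∀ l → sum (replicate l 1) ≡ l
sum-replicate-1 zero    = refl
sum-replicate-1 (suc l) = cong suc (sum-replicate-1 l)

-- Gives access to the summand hidden in the where block of pfBinomSum.
term : ∀ m n k → ∃ λ (f : Vec (Fin n) m → ℕ) → pfBinomSum m n k ≡ ∑ (allSeqs n m) f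
term m n k = _ , refl

term-dispC : ∀ m n k π → proj₁ (term m n k) π ≡ dispC n k 0 π (parkFrom n [] π)
term-dispC m n k π with parkFrom n [] π
... | nothing = refl
... | just o  = refl

pfBinomSum-park : ∀ m t k → pfBinomSum m (m + t) k ≡ park m (suc t) (λ _ d → d C k) (replicate (m + suc t) 1) 0
pfBinomSum-park m t k = trans (∑-cong (allSeqs (m + t) m) (term-dispC m (m + t) k))
  (∑-parkFrom (m + t) k m (suc t) [] (replicate (m + suc t) 1) 0
    (subst (λ l → Segments [] 0 (replicate l 1)) (sym (+-suc m t)) (Segments-empty (m + t) 0))
    (trans (sum-replicate-1 (m + suc t)) (+-suc m t)) (length-replicate (m + suc t)))

-- Splits and subsets of lists

splits : List A → List (List A × A × List A)
splits []       = []
splits (x ∷ xs) = ([] , x , xs) ∷ map (λ (ys , z , zs) → x ∷ ys , z , zs) (splits xs)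

pivot : List A × A × List A → A
pivot (_ , z , _) = z

∈-splits⁻ : ∀ (xs : List A) {ys z zs} → (ys , z , zs) ∈ splits xs → xs ≡ ys ++ z ∷ zs
∈-splits⁻ (x ∷ xs) (here refl) = refl
∈-splits⁻ (x ∷ xs) (there s∈) with _ , s′∈ , refl ← ∈-map⁻ _ s∈ = cong (x ∷_) (∈-splits⁻ xs s′∈)

∈-splits⁺ : ∀ {x : A} {xs} → x ∈ xs → ∃₂ λ ys zs → (ys , x , zs) ∈ splits xs
∈-splits⁺ (here refl) = _ , _ , here refl
∈-splits⁺ (there x∈)  = let _ , _ , s∈ = ∈-splits⁺ x∈ in _ , _ , there (∈-map⁺ _ s∈)

-- The length of the first part is the position of the pivot, so a sum over roots becomes a sum over
-- empty spots.
∑-splits : ∀ (xs : List A) (f : ℕ → ℕ) → ∑ (splits xs) (λ (ys , _) → f (length ys)) ≡ ∑ (upTo (length xs)) f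
∑-splits []       f = refl
∑-splits (x ∷ xs) f = begin
  f 0 + ∑ (map (λ (ys , z , zs) → x ∷ ys , z , zs) (splits xs)) (λ (ys , _) → f (length ys))
    ≡⟨ cong (f 0 +_) (trans (∑-map _ (splits xs) _) (∑-splits xs (f ∘ suc))) ⟩
  f 0 + ∑ (upTo (length xs)) (f ∘ suc)  ≡⟨ ∑-upTo-suc (length xs) f ⟨
  ∑ (upTo (suc (length xs))) f          ∎

-- Distinctness under a key: rooted graphs are told apart by `graph` alone, and splits by their
-- pivot.
Distinct : (A → K) → List A → Set
Distinct f = AllPairs (λ x y → f x ≢ f y)

Distinct-map : ∀ {f : A → K} {g : A′ → K′} {h : A → A′} {xs} → Distinct f xs →
               (∀ {x y} → x ∈ xs → y ∈ xs → g (h x) ≡ g (h y) → f x ≡ f y) → Distinct g (map h xs)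
Distinct-map []        inj = []
Distinct-map (fx≢ ∷ d) inj =
  All.map⁺ (All.tabulate λ y∈ eq → All.lookup fx≢ y∈ (inj (here refl) (there y∈) eq)) ∷
  Distinct-map d (λ x∈ y∈ → inj (there x∈) (there y∈))

Distinct-concatMap : ∀ {f : A → K} {g : A′ → K′} {h : A → List A′} {xs} → Distinct f xs →
                     (∀ {x} → x ∈ xs → Distinct g (h x)) →
                     (∀ {x x′ y y′} → x ∈ xs → x′ ∈ xs → y ∈ h x → y′ ∈ h x′ → g y ≡ g y′ → f x ≡ f x′) →
                     Distinct g (concatMap h xs)
Distinct-concatMap         []        each key = []
Distinct-concatMap {h = h} (fx≢ ∷ d) each key = AllPairs.++⁺ (each (here refl))
  (Distinct-concatMap d (each ∘ there) (λ x∈ x′∈ → key (there x∈) (there x′∈)))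
  (All.tabulate λ y∈ → All.tabulate λ y′∈ eq →
    let _ , x′∈ , y′∈′ = find (∈-concatMap⁻ h y′∈) in
    All.lookup fx≢ x′∈ (key (here refl) (there x′∈) y∈ y′∈′ eq))

Distinct-pivot-splits : ∀ {xs : List A} → Unique xs → Distinct pivot (splits xs)
Distinct-pivot-splits {xs = []}     []        = []
Distinct-pivot-splits {xs = x ∷ xs} (x≢ ∷ xs!) =
  All.map⁺ (All.tabulate λ {(ys , z , zs)} s∈ x≡z →
    All.lookup x≢ (subst (z ∈_) (sym (∈-splits⁻ xs s∈)) (∈-++⁺ʳ ys (here refl))) x≡z) ∷
  Distinct-map (Distinct-pivot-splits xs!) (λ _ _ eq → eq)

subsets : List A → List (List A)
subsets []       = [] ∷ []
subsets (x ∷ xs) = subsets xs ++ map (x ∷_) (subsets xs)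

-- Grouping the nonempty subsets by their first element is the hockey-stick identity.
nonemptySubsets : List A → List (List A)
nonemptySubsets []       = []
nonemptySubsets (x ∷ xs) = map (x ∷_) (subsets xs) ++ nonemptySubsets xs

∑-subsets : ∀ (xs : List A) g → ∑ (subsets xs) (g ∘ length) ≡ binomial (length xs) g
∑-subsets []       g = +-identityʳ (g 0)
∑-subsets (x ∷ xs) g = trans (∑-++ (subsets xs) _ (g ∘ length))
  (cong₂ _+_ (∑-subsets xs g) (trans (∑-map (x ∷_) (subsets xs) (g ∘ length)) (∑-subsets xs (g ∘ suc))))

-- Once the first element is chosen, any subset of the e elements behind it may follow. `pred`
-- discounts the first element.
∑-nonemptySubsets : ∀ (xs : List A) g →
                    ∑ (nonemptySubsets xs) (g ∘ pred ∘ length) ≡ ∑ (downFrom (length xs)) (λ e → binomial e g)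
∑-nonemptySubsets []       g = refl
∑-nonemptySubsets (x ∷ xs) g = trans (∑-++ (map (x ∷_) (subsets xs)) _ _)
  (cong₂ _+_ (trans (∑-map (x ∷_) (subsets xs) _) (∑-subsets xs g)) (∑-nonemptySubsets xs g))

nonempty⇒subset : ∀ (xs : List A) {S} → S ∈ nonemptySubsets xs → S ∈ subsets xs
nonempty⇒subset (x ∷ xs) S∈ with ∈-++⁻ (map (x ∷_) (subsets xs)) S∈
... | inj₁ S∈′ = ∈-++⁺ʳ (subsets xs) S∈′
... | inj₂ S∈′ = ∈-++⁺ˡ (nonempty⇒subset xs S∈′)

nonempty-∷ : ∀ (xs : List A) {S} → S ∈ nonemptySubsets xs → ∃₂ λ y S′ → S ≡ y ∷ S′
nonempty-∷ (x ∷ xs) S∈ with ∈-++⁻ (map (x ∷_) (subsets xs)) S∈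
... | inj₁ S∈′ = let S′ , _ , eq = ∈-map⁻ (x ∷_) S∈′ in x , S′ , eq
... | inj₂ S∈′ = nonempty-∷ xs S∈′

subset-⊆ : ∀ (xs : List A) {S y} → S ∈ subsets xs → y ∈ S → y ∈ xs
subset-⊆ []       (here refl) ()
subset-⊆ (x ∷ xs) S∈ y∈ with ∈-++⁻ (subsets xs) S∈
... | inj₁ S∈′ = there (subset-⊆ xs S∈′ y∈)
... | inj₂ S∈′ with ∈-map⁻ (x ∷_) S∈′ | y∈
...   | _ , _ , refl     | here refl = here refl
...   | _ , S′∈ , refl   | there y∈′ = there (subset-⊆ xs S′∈ y∈′)

Unique-subset : ∀ {xs : List A} {S} → Unique xs → S ∈ subsets xs → Unique S
Unique-subset {xs = []}     []         (here refl) = []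
Unique-subset {xs = x ∷ xs} (x≢ ∷ xs!) S∈ with ∈-++⁻ (subsets xs) S∈
... | inj₁ S∈′ = Unique-subset xs! S∈′
... | inj₂ S∈′ with _ , S′∈ , refl ← ∈-map⁻ (x ∷_) S∈′ =
  All.tabulate (λ y∈ → All.lookup x≢ (subset-⊆ xs S′∈ y∈)) ∷ Unique-subset xs! S′∈

module _ {P : Pred A 0ℓ} (P? : Decidable P) where

  filter-∈-subsets : ∀ xs → filter P? xs ∈ subsets xs
  filter-∈-subsets []       = here refl
  filter-∈-subsets (x ∷ xs) with P? x
  ... | yes _ = ∈-++⁺ʳ (subsets xs) (∈-map⁺ (x ∷_) (filter-∈-subsets xs))
  ... | no  _ = ∈-++⁺ˡ (filter-∈-subsets xs)

  filter-∈-nonemptySubsets : ∀ {xs} → Any P xs → filter P? xs ∈ nonemptySubsets xs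
  filter-∈-nonemptySubsets {x ∷ xs} any with P? x | any
  ... | yes _  | _        = ∈-++⁺ˡ (∈-map⁺ (x ∷_) (filter-∈-subsets xs))
  ... | no ¬px | here px  = contradiction px ¬px
  ... | no _   | there a  = ∈-++⁺ʳ (map (x ∷_) (subsets xs)) (filter-∈-nonemptySubsets a)

  -- Listed subsets keep the order of `xs`, so without duplicates a subset is determined by its
  -- members. This recovers an attached set from the graph.
  subset≡filter : ∀ {xs S} → Unique xs → S ∈ subsets xs → (∀ {x} → x ∈ xs → P x → x ∈ S) →
                  (∀ {x} → x ∈ S → P x) → S ≡ filter P? xs
  subset≡filter {[]}     []         (here refl) _  _    = refl
  subset≡filter {x ∷ xs} (x≢ ∷ xs!) S∈          P⇒ ⇒P with ∈-++⁻ (subsets xs) S∈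
  ... | inj₁ S∈′ = trans (subset≡filter xs! S∈′ (P⇒ ∘ there) ⇒P)
    (sym (filter-reject P? λ px → All.lookup x≢ (subset-⊆ xs S∈′ (P⇒ (here refl) px)) refl))
  ... | inj₂ S∈′ with S′ , S′∈ , refl ← ∈-map⁻ (x ∷_) S∈′ =
    trans (cong (x ∷_) (subset≡filter xs! S′∈ P⇒′ (⇒P ∘ there))) (sym (filter-accept P? (⇒P (here refl))))
    where
    P⇒′ : ∀ {y} → y ∈ xs → P y → y ∈ S′
    P⇒′ y∈ py with P⇒ (there y∈) py
    ... | here refl = contradiction refl (All.lookup x≢ y∈)
    ... | there y∈′ = y∈′

Unique-subsets : ∀ {xs : List A} → Unique xs → Unique (subsets xs)
Unique-subsets {xs = []}     []         = [] ∷ []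
Unique-subsets {xs = x ∷ xs} (x≢ ∷ xs!) = Unique.++⁺ (Unique-subsets xs!)
  (Unique.map⁺ (λ { refl → refl }) (Unique-subsets xs!))
  λ { (S∈ , S∈′) → let _ , _ , eq = ∈-map⁻ (x ∷_) S∈′ in
      All.lookup x≢ (subset-⊆ xs S∈ (subst (x ∈_) (sym eq) (here refl))) refl }

Unique-nonemptySubsets : ∀ {xs : List A} → Unique xs → Unique (nonemptySubsets xs)
Unique-nonemptySubsets {xs = []}     []         = []
Unique-nonemptySubsets {xs = x ∷ xs} (x≢ ∷ xs!) = Unique.++⁺
  (Unique.map⁺ (λ { refl → refl }) (Unique-subsets xs!)) (Unique-nonemptySubsets xs!)
  λ { (S∈′ , S∈) → let _ , _ , eq = ∈-map⁻ (x ∷_) S∈′ in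
      All.lookup x≢ (subset-⊆ xs (nonempty⇒subset xs S∈) (subst (x ∈_) (sym eq) (here refl))) refl }

length-filter-⊎ : {P Q R : Pred A 0ℓ} (P? : Decidable P) (Q? : Decidable Q) (R? : Decidable R) →
                  (∀ {x} → R x → P x ⊎ Q x) → (∀ {x} → P x → R x) → (∀ {x} → Q x → R x) →
                  (∀ {x} → P x → ¬ Q x) →
                  ∀ xs → length (filter R? xs) ≡ length (filter P? xs) + length (filter Q? xs)
length-filter-⊎ P? Q? R? split p⇒r q⇒r p⇒¬q []       = refl
length-filter-⊎ P? Q? R? split p⇒r q⇒r p⇒¬q (x ∷ xs)
  with ih ← length-filter-⊎ P? Q? R? split p⇒r q⇒r p⇒¬q xs | P? x | Q? x | R? x
... | yes p | yes q | _     = contradiction q (p⇒¬q p)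
... | yes p | no  _ | yes _ = cong suc ih
... | yes p | no  _ | no ¬r = contradiction (p⇒r p) ¬r
... | no  _ | yes _ | yes _ = trans (cong suc ih) (sym (+-suc _ _))
... | no  _ | yes q | no ¬r = contradiction (q⇒r q) ¬r
... | no ¬p | no ¬q | yes r = contradiction (split r) [ ¬p , ¬q ]′
... | no  _ | no  _ | no  _ = ih

length-filter-≟ : ∀ {n} {r : Fin n} {xs} → Unique xs → r ∈ xs → length (filter (_≟ r) xs) ≡ 1
length-filter-≟ {r = r} {x ∷ xs} (x≢ ∷ xs!) r∈ with x ≟ r | r∈
... | yes refl | _         = cong (suc ∘ length) (filter-none (_≟ r) (All.map (_∘ sym) x≢))
... | no x≢r   | here refl = contradiction refl x≢r
... | no _     | there r∈′ = length-filter-≟ xs! r∈′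

∑-update : ∀ {xs : List A} {a} {f g : A → ℕ} → Unique xs → a ∈ xs → g a ≡ suc (f a) →
           (∀ {x} → x ≢ a → g x ≡ f x) → ∑ xs g ≡ suc (∑ xs f)
∑-update {xs = x ∷ xs} (x≢ ∷ _) (here refl) ga≡ same =
  cong₂ _+_ ga≡ (∑-cong-∈ xs λ y∈ → same (All.lookup x≢ y∈ ∘ sym))
∑-update {xs = x ∷ xs} {f = f} (x≢ ∷ xs!) (there a∈) ga≡ same =
  trans (cong₂ _+_ (same (All.lookup x≢ a∈)) (∑-update xs! a∈ ga≡ same)) (+-suc (f x) _)

sum-concatMap : (h : A → List ℕ) (xs : List A) → sum (concatMap h xs) ≡ ∑ xs (sum ∘ h)
sum-concatMap h []       = refl
sum-concatMap h (x ∷ xs) = trans (sum-++ (h x) (concatMap h xs)) (cong (sum (h x) +_) (sum-concatMap h xs))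

bool-ext : ∀ {a b : Bool} → (a ≡ true → b ≡ true) → (b ≡ true → a ≡ true) → a ≡ b
bool-ext {true}  {b}     a⇒b _   = sym (a⇒b refl)
bool-ext {false} {true}  _   b⇒a = b⇒a refl
bool-ext {false} {false} _   _   = refl

-- Graphs

module _ {V : ℕ} where

  open import Data.List.Membership.DecPropositional (_≟_ {V}) using (_∈?_)

  lookup-ext : {B : Set} {xs ys : Vec B V} → (∀ i → lookup xs i ≡ lookup ys i) → xs ≡ ys
  lookup-ext {xs = xs} {ys} eq = trans (sym (tabulate∘lookup xs)) (trans (tabulate-cong eq) (tabulate∘lookup ys))

  Adj-ext : (g h : Graph V) → (∀ {i j} → Adj g i j → Adj h i j) → (∀ {i j} → Adj h i j → Adj g i j) → g ≡ h
  Adj-ext g h g⇒h h⇒g = lookup-ext λ i → lookup-ext λ j → bool-ext (g⇒h {i} {j}) (h⇒g {i} {j})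

  Adj? : (g : Graph V) (i j : Fin V) → Dec (Adj g i j)
  Adj? g i j = entry g i j Bool.≟ true

  module _ {P : Fin V → Fin V → Set} (P? : ∀ i j → Dec (P i j)) where

    graphOf : Graph V
    graphOf = Vec.tabulate λ i → Vec.tabulate λ j → does (P? i j)

    entry-graphOf : ∀ i j → entry graphOf i j ≡ does (P? i j)
    entry-graphOf i j = trans (cong (λ row → lookup row j) (lookup∘tabulate _ i)) (lookup∘tabulate _ j)

    Adj-graphOf⁺ : ∀ {i j} → P i j → Adj graphOf i j
    Adj-graphOf⁺ {i} {j} p = trans (entry-graphOf i j) (dec-true (P? i j) p)

    Adj-graphOf⁻ : ∀ {i j} → Adj graphOf i j → P i j
    Adj-graphOf⁻ {i} {j} adj with P? i j | trans (sym (entry-graphOf i j)) adj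
    ... | yes p | _ = p
    ... | no  _ | ()

  -- Edge counts and stars.

  edgeBit : Graph V → Fin V → Fin V → ℕ
  edgeBit g i j = if (toℕ i <ᵇ toℕ j) ∧ entry g i j then 1 else 0

  edgeBit-cong : ∀ g h i j → (toℕ i < toℕ j → entry h i j ≡ entry g i j) → edgeBit h i j ≡ edgeBit g i j
  edgeBit-cong g h i j eq with toℕ i <ᵇ toℕ j in i<ᵇj
  ... | true  = cong (if_then 1 else 0) (eq (<ᵇ⇒< (toℕ i) (toℕ j) (subst T (sym i<ᵇj) _)))
  ... | false = refl

  edgeBit-adj : ∀ g i j → toℕ i < toℕ j → edgeBit g i j ≡ (if entry g i j then 1 else 0)
  edgeBit-adj g i j i<j with toℕ i <ᵇ toℕ j | <⇒<ᵇ i<j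
  ... | true | _ = refl

  edgeCount-∑ : ∀ g → edgeCount g ≡ ∑ (allFin V) (λ i → ∑ (allFin V) (edgeBit g i))
  edgeCount-∑ g = sum-concatMap _ (allFin V)

  -- Only entries above the diagonal are counted, so a new edge changes one summand; `∑-update` is
  -- used once for the rows and once within row `a`.
  edgeCount-suc : ∀ g h {a b} → toℕ a < toℕ b → ¬ Adj g a b → Adj h a b →
                  (∀ {i j} → toℕ i < toℕ j → ¬ (i ≡ a × j ≡ b) → entry h i j ≡ entry g i j) →
                  edgeCount h ≡ suc (edgeCount g)
  edgeCount-suc g h {a} {b} a<b ¬gab hab same = begin
    edgeCount h                                           ≡⟨ edgeCount-∑ h ⟩
    ∑ (allFin V) (λ i → ∑ (allFin V) (edgeBit h i))
      ≡⟨ ∑-update (Unique.allFin⁺ V) (∈-allFin a)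
           (∑-update (Unique.allFin⁺ V) (∈-allFin b) bit (λ {j} j≢b → edgeBit-cong g h a j λ i<j → same i<j (j≢b ∘ proj₂)))
           (λ {i} i≢a → ∑-cong (allFin V) λ j → edgeBit-cong g h i j λ i<j → same i<j (i≢a ∘ proj₁)) ⟩
    suc (∑ (allFin V) (λ i → ∑ (allFin V) (edgeBit g i))) ≡⟨ cong suc (edgeCount-∑ g) ⟨
    suc (edgeCount g)                                     ∎
    where
    bit : edgeBit h a b ≡ suc (edgeBit g a b)
    bit = trans (edgeBit-adj h a b a<b) (trans (cong (if_then 1 else 0) hab)
            (cong suc (sym (trans (edgeBit-adj g a b a<b) (cong (if_then 1 else 0) (Bool.¬-not ¬gab))))))

  edgeless : Graph V
  edgeless = Vec.replicate V (Vec.replicate V false)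

  StarAdj : Fin V → List (Fin V) → Graph V → Fin V → Fin V → Set
  StarAdj v S g i j = Adj g i j ⊎ (i ≡ v × j ∈ S) ⊎ (j ≡ v × i ∈ S)

  starAdj? : ∀ v S g i j → Dec (StarAdj v S g i j)
  starAdj? v S g i j = Adj? g i j ⊎-dec ((i ≟ v ×-dec j ∈? S) ⊎-dec (j ≟ v ×-dec i ∈? S))

  addStar : Fin V → List (Fin V) → Graph V → Graph V
  addStar v S g = graphOf (starAdj? v S g)

  addStar⁺ : ∀ v S g {i j} → StarAdj v S g i j → Adj (addStar v S g) i j
  addStar⁺ v S g = Adj-graphOf⁺ (starAdj? v S g)

  addStar⁻ : ∀ v S g {i j} → Adj (addStar v S g) i j → StarAdj v S g i j
  addStar⁻ v S g = Adj-graphOf⁻ (starAdj? v S g)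

  addStar-[] : ∀ v g → addStar v [] g ≡ g
  addStar-[] v g = Adj-ext (addStar v [] g) g to (λ adj → addStar⁺ v [] g (inj₁ adj))
    where
    to : ∀ {i j} → Adj (addStar v [] g) i j → Adj g i j
    to adj with addStar⁻ v [] g adj
    ... | inj₁ g-ij = g-ij
    ... | inj₂ (inj₁ (_ , ()))
    ... | inj₂ (inj₂ (_ , ()))

  -- The edges are added one at a time. `g` is not assumed symmetric, and an edge is counted at
  -- whichever of (v, y) and (y, v) lies above the diagonal, so freshness speaks of both.
  edgeCount-addStar : ∀ v S g → Unique S → (∀ {y} → y ∈ S → y ≢ v × ¬ Adj g v y × ¬ Adj g y v) →
                      edgeCount (addStar v S g) ≡ edgeCount g + length S
  edgeCount-addStar v []      g _         fresh = trans (cong edgeCount (addStar-[] v g)) (sym (+-identityʳ _))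
  edgeCount-addStar v (y ∷ S) g (y≢ ∷ S!) fresh = begin
    edgeCount (addStar v (y ∷ S) g)    ≡⟨ one-more ⟩
    suc (edgeCount (addStar v S g))    ≡⟨ cong suc (edgeCount-addStar v S g S! (fresh ∘ there)) ⟩
    suc (edgeCount g + length S)       ≡⟨ +-suc _ _ ⟨
    edgeCount g + length (y ∷ S)       ∎
    where
    y≢v : y ≢ v
    y≢v = proj₁ (fresh (here refl))
    y∉S : y ∉ S
    y∉S y∈S = All.lookup y≢ y∈S refl
    same : ∀ {i j} → ¬ (i ≡ v × j ≡ y) → ¬ (i ≡ y × j ≡ v) → entry (addStar v (y ∷ S) g) i j ≡ entry (addStar v S g) i j
    same {i} {j} ≢vy ≢yv = bool-ext to from
      where
      to : Adj (addStar v (y ∷ S) g) i j → Adj (addStar v S g) i j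
      to adj with addStar⁻ v (y ∷ S) g adj
      ... | inj₁ g-ij                        = addStar⁺ v S g (inj₁ g-ij)
      ... | inj₂ (inj₁ (refl , here refl))   = contradiction (refl , refl) ≢vy
      ... | inj₂ (inj₁ (refl , there j∈))    = addStar⁺ v S g (inj₂ (inj₁ (refl , j∈)))
      ... | inj₂ (inj₂ (refl , here refl))   = contradiction (refl , refl) ≢yv
      ... | inj₂ (inj₂ (refl , there i∈))    = addStar⁺ v S g (inj₂ (inj₂ (refl , i∈)))
      from : Adj (addStar v S g) i j → Adj (addStar v (y ∷ S) g) i j
      from adj with addStar⁻ v S g adj
      ... | inj₁ g-ij               = addStar⁺ v (y ∷ S) g (inj₁ g-ij)
      ... | inj₂ (inj₁ (refl , j∈)) = addStar⁺ v (y ∷ S) g (inj₂ (inj₁ (refl , there j∈)))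
      ... | inj₂ (inj₂ (refl , i∈)) = addStar⁺ v (y ∷ S) g (inj₂ (inj₂ (refl , there i∈)))
    ¬vy : ¬ Adj (addStar v S g) v y
    ¬vy adj with addStar⁻ v S g adj
    ... | inj₁ g-vy              = proj₁ (proj₂ (fresh (here refl))) g-vy
    ... | inj₂ (inj₁ (_ , y∈))   = y∉S y∈
    ... | inj₂ (inj₂ (y≡v , _))  = y≢v y≡v
    ¬yv : ¬ Adj (addStar v S g) y v
    ¬yv adj with addStar⁻ v S g adj
    ... | inj₁ g-yv              = proj₂ (proj₂ (fresh (here refl))) g-yv
    ... | inj₂ (inj₁ (y≡v , _))  = y≢v y≡v
    ... | inj₂ (inj₂ (_ , y∈))   = y∉S y∈
    one-more : edgeCount (addStar v (y ∷ S) g) ≡ suc (edgeCount (addStar v S g))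
    one-more with <-cmp (toℕ v) (toℕ y)
    ... | tri< v<y _ _ = edgeCount-suc (addStar v S g) (addStar v (y ∷ S) g) v<y ¬vy (addStar⁺ v (y ∷ S) g (inj₂ (inj₁ (refl , here refl))))
                           λ i<j ≢vy → same ≢vy λ { (refl , refl) → <-asym v<y i<j }
    ... | tri≈ _ v≡y _ = contradiction (sym (toℕ-injective v≡y)) y≢v
    ... | tri> _ _ y<v = edgeCount-suc (addStar v S g) (addStar v (y ∷ S) g) y<v ¬yv (addStar⁺ v (y ∷ S) g (inj₂ (inj₂ (refl , here refl))))
                           λ i<j ≢yv → same (λ { (refl , refl) → <-asym y<v i<j }) ≢yv

  -- A graph in which every component contains exactly one vertex of R, with
  -- ρ sending each vertex to the vertex of R in its component.
  record Rooted (R : List (Fin V)) (g : Graph V) (ρ : Fin V → Fin V) : Set where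
    field
      irreflexive : ∀ {x} → ¬ Adj g x x
      symmetric   : ∀ {x y} → Adj g x y → Adj g y x
      root-∈      : ∀ x → ρ x ∈ R
      root-fixed  : ∀ {r} → r ∈ R → ρ r ≡ r
      connected   : ∀ x → Connected g (ρ x) x
      adj-root    : ∀ {x y} → Adj g x y → ρ x ≡ ρ y

  open Rooted

  connected-root : ∀ {R g ρ x y} → Rooted R g ρ → Connected g x y → ρ x ≡ ρ y
  connected-root G ε          = refl
  connected-root G (adj ◅ as) = trans (adj-root G adj) (connected-root G as)

  -- `ρ′` is constant along the path from `ρ x` to `x` and fixes the root `ρ x`. The graph thus
  -- determines its root map, and graphs can be compared without it.
  root-unique : ∀ {R g ρ ρ′} → Rooted R g ρ → Rooted R g ρ′ → ∀ x → ρ x ≡ ρ′ x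
  root-unique G G′ x = trans (sym (root-fixed G′ (root-∈ G x))) (connected-root G′ (connected G x))

  Connected-sym : ∀ {g : Graph V} → (∀ {x y} → Adj g x y → Adj g y x) → ∀ {x y} → Connected g x y → Connected g y x
  Connected-sym {g} sym-g ε          = ε
  Connected-sym {g} sym-g (adj ◅ as) = Connected-sym {g} sym-g as ◅◅ (sym-g adj ◅ ε)

  -- `R` lists the current specified vertices and `U` the remaining ones, in the order of their
  -- removal.
  record Layout (R U : List (Fin V)) : Set where
    field
      unique   : Unique R
      unique′  : Unique U
      disjoint : ∀ {x} → x ∈ R → x ∉ U
      cover    : ∀ x → x ∈ R ⊎ x ∈ U

  open Layout

  Split : Set
  Split = List (Fin V) × Fin V × List (Fin V)

  insertAfter : Fin V → Split → List (Fin V)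
  insertAfter v (A , r , B) = A ++ r ∷ v ∷ B

  module _ {R : List (Fin V)} (v : Fin V) {A r B} (s∈ : (A , r , B) ∈ splits R) where

    insertAfter-↭ : insertAfter v (A , r , B) ↭ v ∷ R
    insertAfter-↭ = ↭-trans (↭-reflexive (sym (++-assoc A (r ∷ []) (v ∷ B))))
      (↭-trans (shift v (A ++ r ∷ []) B)
        (↭-reflexive (cong (v ∷_) (trans (++-assoc A (r ∷ []) B) (sym (∈-splits⁻ R s∈))))))

    ∈-insertAfter⁺ : ∀ {x} → x ∈ R → x ∈ insertAfter v (A , r , B)
    ∈-insertAfter⁺ x∈ = ∈-resp-↭ (↭-sym insertAfter-↭) (there x∈)

    v-∈-insertAfter : v ∈ insertAfter v (A , r , B)
    v-∈-insertAfter = ∈-resp-↭ (↭-sym insertAfter-↭) (here refl)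

    ∈-insertAfter⁻ : ∀ {x} → x ∈ insertAfter v (A , r , B) → x ≡ v ⊎ x ∈ R
    ∈-insertAfter⁻ x∈ with ∈-resp-↭ insertAfter-↭ x∈
    ... | here x≡v  = inj₁ x≡v
    ... | there x∈′ = inj₂ x∈′

    pivot-∈ : r ∈ R
    pivot-∈ = subst (r ∈_) (sym (∈-splits⁻ R s∈)) (∈-++⁺ʳ A (here refl))

    length-insertAfter : length (insertAfter v (A , r , B)) ≡ suc (length R)
    length-insertAfter = ↭-length insertAfter-↭

    Layout-insertAfter : ∀ {U} → Layout R (v ∷ U) → Layout (insertAfter v (A , r , B)) U
    Layout-insertAfter {U} L = record
      { unique   = Permutation.Unique-resp-↭ (setoid (Fin V)) (↭⇒↭ₛ (↭-sym insertAfter-↭))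
                     (All.tabulate (λ x∈ v≡x → disjoint L x∈ (here (sym v≡x))) ∷ unique L)
      ; unique′  = AllPairs.tail (unique′ L)
      ; disjoint = λ x∈ x∈U → [ (λ { refl → All.lookup (AllPairs.head (unique′ L)) x∈U refl })
                              , (λ x∈R → disjoint L x∈R (there x∈U)) ]′ (∈-insertAfter⁻ x∈)
      ; cover    = cover′
      }
      where
      cover′ : ∀ x → x ∈ insertAfter v (A , r , B) ⊎ x ∈ U
      cover′ x with cover L x
      ... | inj₁ x∈R          = inj₁ (∈-insertAfter⁺ x∈R)
      ... | inj₂ (here refl)  = inj₁ v-∈-insertAfter
      ... | inj₂ (there x∈U)  = inj₂ x∈U

  -- Component classes and the enumeration of rooted graphs.

  class : (Fin V → Fin V) → Fin V → List (Fin V)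
  class ρ r = filter (λ x → ρ x ≟ r) (allFin V)

  ∈-class⁺ : ∀ ρ {r x} → ρ x ≡ r → x ∈ class ρ r
  ∈-class⁺ ρ {r} {x} = ∈-filter⁺ (λ x → ρ x ≟ r) (∈-allFin x)

  ∈-class⁻ : ∀ ρ {r x} → x ∈ class ρ r → ρ x ≡ r
  ∈-class⁻ ρ {r} x∈ = proj₂ (∈-filter⁻ (λ x → ρ x ≟ r) {xs = allFin V} x∈)

  Unique-class : ∀ ρ r → Unique (class ρ r)
  Unique-class ρ r = Unique.filter⁺ (λ x → ρ x ≟ r) (Unique.allFin⁺ V)

  sizes : List (Fin V) → (Fin V → Fin V) → Configuration
  sizes R ρ = map (length ∘ class ρ) R

  -- The root map after the component of `v` has been joined to that of `r`.
  relabel : Fin V → Fin V → (Fin V → Fin V) → Fin V → Fin V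
  relabel v r ρ x = if does (ρ x ≟ v) then r else ρ x

  relabel-≡ : ∀ {v r} ρ {x} → ρ x ≡ v → relabel v r ρ x ≡ r
  relabel-≡ {v} {r} ρ {x} eq = cong (if_then r else ρ x) (dec-true (ρ x ≟ v) eq)

  relabel-≢ : ∀ {v r} ρ {x} → ρ x ≢ v → relabel v r ρ x ≡ ρ x
  relabel-≢ {v} {r} ρ {x} ne = cong (if_then r else ρ x) (dec-false (ρ x ≟ v) ne)

  -- The excess of a graph is its number of edges beyond a spanning forest.
  record RootedGraph : Set where
    no-eta-equality
    constructor rootedGraph
    field
      graph  : Graph V
      rootOf : Fin V → Fin V
      excess : ℕ

  open RootedGraph

  -- One edge of the star joins the two components and extends the spanning forest; each of the
  -- others adds 1 to the excess.
  attach : Fin V → Fin V → RootedGraph → List (Fin V) → RootedGraph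
  attach v r e S = rootedGraph (addStar v S (graph e)) (relabel v r (rootOf e)) (excess e + pred (length S))

  attachments : Fin V → Fin V → RootedGraph → List RootedGraph
  attachments v r e = map (attach v r e) (nonemptySubsets (class (rootOf e) r))

  -- The head of `U` is attached last: in the graphs built from the tail it is still a root, placed
  -- behind its pivot.
  rootedGraphs : List (Fin V) → List (Fin V) → List RootedGraph
  rootedGraphs R []      = rootedGraph edgeless id 0 ∷ []
  rootedGraphs R (v ∷ U) =
    concatMap (λ s → concatMap (attachments v (pivot s)) (rootedGraphs (insertAfter v s) U)) (splits R)

  Adj-edgeless : ∀ {x y} → ¬ Adj edgeless x y
  Adj-edgeless {x} {y} adj with trans (sym (trans (cong (λ row → lookup row y) (lookup-replicate x _)) (lookup-replicate y false))) adj
  ... | ()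

  edgeCount-edgeless : edgeCount edgeless ≡ 0
  edgeCount-edgeless = trans (edgeCount-∑ edgeless)
    (trans (∑-cong (allFin V) λ i → trans (∑-cong (allFin V) λ j → bit i j) (∑-zero (allFin V))) (∑-zero (allFin V)))
    where
    bit : ∀ i j → edgeBit edgeless i j ≡ 0
    bit i j with toℕ i <ᵇ toℕ j
    ... | true  = cong (if_then 1 else 0) (Bool.¬-not (Adj-edgeless {i} {j}))
    ... | false = refl

  Rooted-edgeless : ∀ {R} → Layout R [] → Rooted R edgeless id
  Rooted-edgeless L = record
    { irreflexive = λ {x} → Adj-edgeless {x} {x}
    ; symmetric   = λ {x} {y} adj → ⊥-elim (Adj-edgeless {x} {y} adj)
    ; root-∈      = λ x → [ id , (λ ()) ]′ (cover L x)
    ; root-fixed  = λ _ → refl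
    ; connected   = λ _ → ε
    ; adj-root    = λ {x} {y} adj → ⊥-elim (Adj-edgeless {x} {y} adj)
    }

  -- The enumeration is sound and free of repetitions.

  module _ {R U v A r B} (L : Layout R (v ∷ U)) (s∈ : (A , r , B) ∈ splits R) where

    v∉R : v ∉ R
    v∉R v∈R = disjoint L v∈R (here refl)

    r≢v : r ≢ v
    r≢v refl = v∉R (pivot-∈ v s∈)

    module _ {g ρ} (G : Rooted (insertAfter v (A , r , B)) g ρ) where

      ρv≡v : ρ v ≡ v
      ρv≡v = root-fixed G (v-∈-insertAfter v s∈)

      ρr≡r : ρ r ≡ r
      ρr≡r = root-fixed G (∈-insertAfter⁺ v s∈ (pivot-∈ v s∈))

      class-≢v : ∀ {y} → ρ y ≡ r → y ≢ v
      class-≢v ρy≡r refl = r≢v (trans (sym ρy≡r) ρv≡v)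

      class-¬Adj : ∀ {y} → ρ y ≡ r → ¬ Adj g v y
      class-¬Adj ρy≡r adj = r≢v (trans (sym ρy≡r) (trans (sym (adj-root G adj)) ρv≡v))

      module _ {S} (S∈ : S ∈ nonemptySubsets (class ρ r)) where

        S⊆class : ∀ {y} → y ∈ S → ρ y ≡ r
        S⊆class y∈ = ∈-class⁻ ρ (subset-⊆ (class ρ r) (nonempty⇒subset (class ρ r) S∈) y∈)

        -- Every new edge joins `v` to the class of `r`, so exactly these two components become one,
        -- with root `r`.
        Rooted-attach : Rooted R (addStar v S g) (relabel v r ρ)
        Rooted-attach = record
          { irreflexive = irrefl
          ; symmetric   = symm
          ; root-∈      = root-∈′
          ; root-fixed  = λ {q} q∈ → trans (relabel-≢ ρ (λ ρq≡v → v∉R (subst (_∈ R)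
                            (trans (sym (root-fixed G (∈-insertAfter⁺ v s∈ q∈))) ρq≡v) q∈)))
                            (root-fixed G (∈-insertAfter⁺ v s∈ q∈))
          ; connected   = conn
          ; adj-root    = adj-root′
          }
          where
          g′ : Graph V
          g′ = addStar v S g
          irrefl : ∀ {x} → ¬ Adj g′ x x
          irrefl adj with addStar⁻ v S g adj
          ... | inj₁ g-xx               = irreflexive G g-xx
          ... | inj₂ (inj₁ (refl , x∈)) = class-≢v (S⊆class x∈) refl
          ... | inj₂ (inj₂ (refl , x∈)) = class-≢v (S⊆class x∈) refl
          symm : ∀ {x y} → Adj g′ x y → Adj g′ y x
          symm adj with addStar⁻ v S g adj
          ... | inj₁ g-xy          = addStar⁺ v S g (inj₁ (symmetric G g-xy))
          ... | inj₂ (inj₁ (p , q)) = addStar⁺ v S g (inj₂ (inj₂ (p , q)))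
          ... | inj₂ (inj₂ (p , q)) = addStar⁺ v S g (inj₂ (inj₁ (p , q)))
          root-∈′ : ∀ x → relabel v r ρ x ∈ R
          root-∈′ x with ρ x ≟ v
          ... | yes _ = pivot-∈ v s∈
          ... | no ρx≢v = [ (λ ρx≡v → contradiction ρx≡v ρx≢v) , id ]′ (∈-insertAfter⁻ v s∈ (root-∈ G x))
          lift : ∀ {x y} → Connected g x y → Connected g′ x y
          lift ε          = ε
          lift (adj ◅ as) = addStar⁺ v S g (inj₁ adj) ◅ lift as
          conn : ∀ x → Connected g′ (relabel v r ρ x) x
          conn x with ρ x ≟ v
          ... | no  _    = lift (connected G x)
          -- Nonemptiness of `S` gives the path: from `r` to some `y` in `S`, over the new edge to
          -- `v`, and on to `x`.
          ... | yes ρx≡v with y , _ , refl ← nonempty-∷ (class ρ r) S∈ =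
            lift (subst (λ z → Connected g z y) (S⊆class (here refl)) (connected G y)) ◅◅
            (addStar⁺ v S g {y} {v} (inj₂ (inj₂ (refl , here refl))) ◅
             lift (subst (λ z → Connected g z x) ρx≡v (connected G x)))
          adj-root′ : ∀ {x y} → Adj g′ x y → relabel v r ρ x ≡ relabel v r ρ y
          adj-root′ adj with addStar⁻ v S g adj
          ... | inj₁ g-xy = cong (λ q → if does (q ≟ v) then r else q) (adj-root G g-xy)
          ... | inj₂ (inj₁ (refl , y∈)) = trans (relabel-≡ ρ ρv≡v)
            (sym (trans (relabel-≢ ρ (r≢v ∘ trans (sym (S⊆class y∈)))) (S⊆class y∈)))
          ... | inj₂ (inj₂ (refl , x∈)) = trans (trans (relabel-≢ ρ (r≢v ∘ trans (sym (S⊆class x∈)))) (S⊆class x∈))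
            (sym (relabel-≡ ρ ρv≡v))

        edgeCount-attach : edgeCount (addStar v S g) ≡ suc (edgeCount g + pred (length S))
        edgeCount-attach = begin
          edgeCount (addStar v S g)
            ≡⟨ edgeCount-addStar v S g (Unique-subset (Unique-class ρ r) (nonempty⇒subset (class ρ r) S∈))
                 (λ y∈ → class-≢v (S⊆class y∈) , class-¬Adj (S⊆class y∈) , class-¬Adj (S⊆class y∈) ∘ symmetric G) ⟩
          edgeCount g + length S                ≡⟨ cong (edgeCount g +_) length-S ⟩
          edgeCount g + suc (pred (length S))   ≡⟨ +-suc _ _ ⟩
          suc (edgeCount g + pred (length S))   ∎
          where
          length-S : length S ≡ suc (pred (length S))
          length-S with _ , _ , refl ← nonempty-∷ (class ρ r) S∈ = refl

        -- Before the attachment `v` has no neighbour in the class of `r`, which lies in another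
        -- component; afterwards its neighbours there are exactly `S`.
        S≡neighbours : S ≡ filter (Adj? (addStar v S g) v) (class ρ r)
        S≡neighbours = subset≡filter (Adj? (addStar v S g) v) (Unique-class ρ r) (nonempty⇒subset (class ρ r) S∈)
          to (λ y∈ → addStar⁺ v S g (inj₂ (inj₁ (refl , y∈))))
          where
          to : ∀ {y} → y ∈ class ρ r → Adj (addStar v S g) v y → y ∈ S
          to y∈ adj with addStar⁻ v S g adj
          ... | inj₁ g-vy              = ⊥-elim (class-¬Adj (∈-class⁻ ρ y∈) g-vy)
          ... | inj₂ (inj₁ (_ , y∈S))  = y∈S
          ... | inj₂ (inj₂ (y≡v , _))  = contradiction y≡v (class-≢v (∈-class⁻ ρ y∈))

    -- Follow a path from `r` in `g₁`. It never meets `v`, which has another root, so none of its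
    -- edges belongs to the star of `S₂`, and all of them lie in `g₂`.
    class-⊆ : ∀ {g₁ ρ₁ g₂ ρ₂ S₁ S₂} → Rooted (insertAfter v (A , r , B)) g₁ ρ₁ → Rooted (insertAfter v (A , r , B)) g₂ ρ₂ →
              addStar v S₁ g₁ ≡ addStar v S₂ g₂ → ∀ {x} → ρ₁ x ≡ r → ρ₂ x ≡ r
    class-⊆ {g₁} {ρ₁} {g₂} {ρ₂} {S₁} {S₂} G₁ G₂ eq {x} ρ₁x≡r =
      walk (ρr≡r G₁) (ρr≡r G₂) (subst (λ z → Connected g₁ z x) ρ₁x≡r (connected G₁ x))
      where
      walk : ∀ {a} → ρ₁ a ≡ r → ρ₂ a ≡ r → Connected g₁ a x → ρ₂ x ≡ r
      walk _     ρ₂a≡r ε          = ρ₂a≡r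
      walk {a} ρ₁a≡r ρ₂a≡r (_◅_ {j = b} adj as) = walk ρ₁b≡r (trans (sym (adj-root G₂ adj₂)) ρ₂a≡r) as
        where
        ρ₁b≡r : ρ₁ b ≡ r
        ρ₁b≡r = trans (sym (adj-root G₁ adj)) ρ₁a≡r
        adj₂ : Adj g₂ a b
        adj₂ with addStar⁻ v S₂ g₂ (subst (λ h → Adj h a b) eq (addStar⁺ v S₁ g₁ (inj₁ adj)))
        ... | inj₁ g₂-ab             = g₂-ab
        ... | inj₂ (inj₁ (a≡v , _))  = contradiction a≡v (class-≢v G₁ ρ₁a≡r)
        ... | inj₂ (inj₂ (b≡v , _))  = contradiction b≡v (class-≢v G₁ ρ₁b≡r)

    -- An edge of `g₁` missing from `g₂` would join `v` to a member of `S₂`. By `class-⊆` that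
    -- member also has root `r` in `g₁`, where `v` lies in a different component.
    Adj-⊆ : ∀ {g₁ ρ₁ g₂ ρ₂ S₁ S₂} → Rooted (insertAfter v (A , r , B)) g₁ ρ₁ → Rooted (insertAfter v (A , r , B)) g₂ ρ₂ →
            S₂ ∈ nonemptySubsets (class ρ₂ r) → addStar v S₁ g₁ ≡ addStar v S₂ g₂ →
            ∀ {x y} → Adj g₁ x y → Adj g₂ x y
    Adj-⊆ {g₁} {ρ₁} {g₂} {ρ₂} {S₁} {S₂} G₁ G₂ S₂∈ eq {x} {y} adj
      with addStar⁻ v S₂ g₂ (subst (λ h → Adj h x y) eq (addStar⁺ v S₁ g₁ (inj₁ adj)))
    ... | inj₁ g₂-xy              = g₂-xy
    ... | inj₂ (inj₁ (refl , y∈)) = ⊥-elim (class-¬Adj G₁ (class-⊆ {g₂} {ρ₂} {g₁} {ρ₁} {S₂} {S₁} G₂ G₁ (sym eq) (S⊆class G₂ S₂∈ y∈)) adj)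
    ... | inj₂ (inj₂ (refl , x∈)) =
      ⊥-elim (class-¬Adj G₁ (class-⊆ {g₂} {ρ₂} {g₁} {ρ₁} {S₂} {S₁} G₂ G₁ (sym eq) (S⊆class G₂ S₂∈ x∈)) (symmetric G₁ adj))

  ∈-rootedGraphs-∷⁻ : ∀ {R v U e} → e ∈ rootedGraphs R (v ∷ U) →
    ∃ λ s → s ∈ splits R × ∃ λ e′ → e′ ∈ rootedGraphs (insertAfter v s) U ×
    ∃ λ S → S ∈ nonemptySubsets (class (rootOf e′) (pivot s)) × e ≡ attach v (pivot s) e′ S
  ∈-rootedGraphs-∷⁻ {R} {v} {U} e∈ with s , s∈ , e∈₁ ← find (∈-concatMap⁻ _ {xs = splits R} e∈)
    with e′ , e′∈ , e∈₂ ← find (∈-concatMap⁻ (attachments v (pivot s)) {xs = rootedGraphs (insertAfter v s) U} e∈₁)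
    with S , S∈ , eq ← ∈-map⁻ (attach v (pivot s) e′) e∈₂ = s , s∈ , e′ , e′∈ , S , S∈ , eq

  rootedGraphs-sound : ∀ {R U e} → Layout R U → e ∈ rootedGraphs R U →
                       Rooted R (graph e) (rootOf e) × edgeCount (graph e) ≡ length U + excess e
  rootedGraphs-sound {U = []}    L (here refl) = Rooted-edgeless L , edgeCount-edgeless
  rootedGraphs-sound {R} {v ∷ U} L e∈
    with s , s∈ , e′ , e′∈ , S , S∈ , refl ← ∈-rootedGraphs-∷⁻ {R} {v} {U} e∈
    with G , edges ← rootedGraphs-sound (Layout-insertAfter v s∈ L) e′∈
    = Rooted-attach L s∈ G S∈ ,
      trans (edgeCount-attach L s∈ G S∈) (cong suc (trans (cong (_+ pred (length S)) edges) (+-assoc (length U) _ _)))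

  -- A graph determines the choices that built it: the pivot is the root of `v`, the smaller graph
  -- follows from `Adj-⊆`, and the attached set from `S≡neighbours`.
  rootedGraphs-distinct : ∀ {R U} → Layout R U → Distinct graph (rootedGraphs R U)
  rootedGraphs-distinct {R} {[]}    L = [] ∷ []
  rootedGraphs-distinct {R} {v ∷ U} L = Distinct-concatMap (Distinct-pivot-splits (unique L))
    (λ {s} s∈ → Distinct-concatMap (IH s∈)
      (λ {e} e∈ → Distinct-map (Unique-nonemptySubsets (Unique-class _ _)) λ S₁∈ S₂∈ eq →
        trans (S≡neighbours L s∈ (rooted s∈ e∈) S₁∈)
          (trans (cong (λ h → filter (Adj? h v) (class (rootOf e) (pivot s))) eq) (sym (S≡neighbours L s∈ (rooted s∈ e∈) S₂∈))))
      (same-graph s∈))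
    same-pivot
    where
    IH : ∀ {s} → s ∈ splits R → Distinct graph (rootedGraphs (insertAfter v s) U)
    IH s∈ = rootedGraphs-distinct (Layout-insertAfter v s∈ L)
    rooted : ∀ {s e} → s ∈ splits R → e ∈ rootedGraphs (insertAfter v s) U → Rooted (insertAfter v s) (graph e) (rootOf e)
    rooted s∈ e∈ = proj₁ (rootedGraphs-sound (Layout-insertAfter v s∈ L) e∈)
    same-graph : ∀ {s e₁ e₂ h₁ h₂} → s ∈ splits R →
                 e₁ ∈ rootedGraphs (insertAfter v s) U → e₂ ∈ rootedGraphs (insertAfter v s) U →
                 h₁ ∈ attachments v (pivot s) e₁ → h₂ ∈ attachments v (pivot s) e₂ →
                 graph h₁ ≡ graph h₂ → graph e₁ ≡ graph e₂
    same-graph {s} {e₁} {e₂} s∈ e₁∈ e₂∈ h₁∈ h₂∈ eq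
      with S₁ , S₁∈ , refl ← ∈-map⁻ (attach v (pivot s) e₁) h₁∈
      with S₂ , S₂∈ , refl ← ∈-map⁻ (attach v (pivot s) e₂) h₂∈
      = Adj-ext (graph e₁) (graph e₂)
          (Adj-⊆ L s∈ {S₁ = S₁} {S₂ = S₂} (rooted s∈ e₁∈) (rooted s∈ e₂∈) S₂∈ eq)
          (Adj-⊆ L s∈ {S₁ = S₂} {S₂ = S₁} (rooted s∈ e₂∈) (rooted s∈ e₁∈) S₁∈ (sym eq))
    same-pivot : ∀ {s₁ s₂ h₁ h₂} → s₁ ∈ splits R → s₂ ∈ splits R →
                 h₁ ∈ concatMap (attachments v (pivot s₁)) (rootedGraphs (insertAfter v s₁) U) →
                 h₂ ∈ concatMap (attachments v (pivot s₂)) (rootedGraphs (insertAfter v s₂) U) →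
                 graph h₁ ≡ graph h₂ → pivot s₁ ≡ pivot s₂
    same-pivot {s₁} {s₂} s₁∈ s₂∈ h₁∈ h₂∈ eq
      with e₁ , e₁∈ , h₁∈′ ← find (∈-concatMap⁻ (attachments v (pivot s₁)) {xs = rootedGraphs (insertAfter v s₁) U} h₁∈)
      with e₂ , e₂∈ , h₂∈′ ← find (∈-concatMap⁻ (attachments v (pivot s₂)) {xs = rootedGraphs (insertAfter v s₂) U} h₂∈)
      with S₁ , S₁∈ , refl ← ∈-map⁻ (attach v (pivot s₁) e₁) h₁∈′
      with S₂ , S₂∈ , refl ← ∈-map⁻ (attach v (pivot s₂) e₂) h₂∈′
      = trans (sym (relabel-≡ (rootOf e₁) (ρv≡v L s₁∈ (rooted s₁∈ e₁∈))))
          (trans (root-unique (Rooted-attach L s₁∈ (rooted s₁∈ e₁∈) S₁∈)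
                    (subst (λ h → Rooted R h (relabel v (pivot s₂) (rootOf e₂))) (sym eq) (Rooted-attach L s₂∈ (rooted s₂∈ e₂∈) S₂∈)) v)
                 (relabel-≡ (rootOf e₂) (ρv≡v L s₂∈ (rooted s₂∈ e₂∈))))

  -- Reachability and completeness of the enumeration.

  record Reachable (H : Fin V → Fin V → Set) (r : Fin V) : Set where
    field
      members : List (Fin V)
      start   : r ∈ members
      reach   : ∀ {z} → z ∈ members → Star H r z
      closed  : ∀ {x z} → z ∈ members → H z x → x ∈ members

  module _ {H : Fin V → Fin V → Set} (H? : ∀ x y → Dec (H x y)) (r : Fin V) where

    -- Unseen vertices adjacent to `Z` move into `Z` one by one; when there are none, `Z` is closed.
    -- Each move shortens `unseen`, whose length is bounded by `fuel`.
    search : ∀ fuel Z unseen → length unseen ≤ fuel → (∀ x → x ∈ Z ⊎ x ∈ unseen) →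
             r ∈ Z → (∀ {z} → z ∈ Z → Star H r z) → Reachable H r
    search fuel Z unseen bound cover r∈ reach with any? (λ x → any? (λ z → H? z x) Z) unseen
    ... | no none = record { members = Z ; start = r∈ ; reach = reach ; closed = closed }
      where
      closed : ∀ {x z} → z ∈ Z → H z x → x ∈ Z
      closed {x} z∈ zx with cover x
      ... | inj₁ x∈Z = x∈Z
      ... | inj₂ x∈unseen = contradiction (lose x∈unseen (lose z∈ zx)) none
    ... | yes some with x , x∈ , z∈zx ← find some
      with z , z∈ , zx ← find z∈zx
      with ys , zs , refl ← ∈-∃++ x∈
      with fuel
    ...   | zero = contradiction (subst (_≤ 0) (length-++-sucʳ ys x zs) bound) λ ()
    ...   | suc fuel′ = search fuel′ (x ∷ Z) (ys ++ zs) (s≤s⁻¹ (subst (_≤ suc fuel′) (length-++-sucʳ ys x zs) bound))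
                          cover′ (there r∈) reach′
      where
      cover′ : ∀ y → y ∈ x ∷ Z ⊎ y ∈ ys ++ zs
      cover′ y with cover y
      ... | inj₁ y∈Z = inj₁ (there y∈Z)
      ... | inj₂ y∈ with ∈-++⁻ ys y∈
      ...   | inj₁ y∈ys         = inj₂ (∈-++⁺ˡ y∈ys)
      ...   | inj₂ (here refl)  = inj₁ (here refl)
      ...   | inj₂ (there y∈zs) = inj₂ (∈-++⁺ʳ ys y∈zs)
      reach′ : ∀ {y} → y ∈ x ∷ Z → Star H r y
      reach′ (here refl) = reach z∈ ◅◅ (zx ◅ ε)
      reach′ (there y∈)  = reach y∈

    -- Having the members as a list makes membership decidable, which the definition of the graph
    -- with deleted edges requires.
    reachable : Reachable H r
    reachable = search (length (allFin V)) (r ∷ []) (allFin V) ≤-refl (inj₂ ∘ ∈-allFin) (here refl) λ { (here refl) → ε }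

  Avoiding : Graph V → Fin V → Fin V → Fin V → Set
  Avoiding g v x y = Adj g x y × x ≢ v × y ≢ v

  avoiding? : ∀ g v x y → Dec (Avoiding g v x y)
  avoiding? g v x y = Adj? g x y ×-dec (¬? (x ≟ v) ×-dec ¬? (y ≟ v))

  -- Deleting the edges from v to the component, in g - v, of the root r of v
  -- makes v the root of the rest of its component.
  module Detach {R U v g ρ} (L : Layout R (v ∷ U)) (G : Rooted R g ρ)
                {A B} (s∈ : (A , ρ v , B) ∈ splits R) (C : Reachable (Avoiding g v) (ρ v)) where

    open Reachable C renaming (members to Z)

    r : Fin V
    r = ρ v

    r≢v′ : r ≢ v
    r≢v′ = r≢v L s∈

    Z-≢v : ∀ {z} → z ∈ Z → z ≢ v
    Z-≢v z∈ = go (reach z∈) r≢v′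
      where
      go : ∀ {x z} → Star (Avoiding g v) x z → x ≢ v → z ≢ v
      go ε                     x≢v = x≢v
      go ((_ , _ , y≢v) ◅ path) _  = go path y≢v

    Z-root : ∀ {z} → z ∈ Z → ρ z ≡ r
    Z-root z∈ = trans (sym (connected-root G (gmap id proj₁ (reach z∈)))) (root-fixed G (root-∈ G v))

    v∉Z : v ∉ Z
    v∉Z v∈ = Z-≢v v∈ refl

    Cut : Fin V → Fin V → Set
    Cut x y = (x ≡ v × y ∈ Z) ⊎ (y ≡ v × x ∈ Z)

    Kept : Fin V → Fin V → Set
    Kept x y = Adj g x y × ¬ Cut x y

    kept? : ∀ x y → Dec (Kept x y)
    kept? x y = Adj? g x y ×-dec ¬? ((x ≟ v ×-dec y ∈? Z) ⊎-dec (y ≟ v ×-dec x ∈? Z))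

    g′ : Graph V
    g′ = graphOf kept?

    -- The part of the old component that reaches `r` only through `v`; it becomes the component of
    -- `v`.
    InRest : Fin V → Set
    InRest x = ρ x ≡ r × x ∉ Z

    inRest? : ∀ x → Dec (InRest x)
    inRest? x = ρ x ≟ r ×-dec ¬? (x ∈? Z)

    ρ′ : Fin V → Fin V
    ρ′ x = if does (inRest? x) then v else ρ x

    ρ′-rest : ∀ {x} → InRest x → ρ′ x ≡ v
    ρ′-rest {x} rest = cong (if_then v else ρ x) (dec-true (inRest? x) rest)

    ρ′-other : ∀ {x} → ¬ InRest x → ρ′ x ≡ ρ x
    ρ′-other {x} other = cong (if_then v else ρ x) (dec-false (inRest? x) other)

    rest-v : InRest v
    rest-v = refl , v∉Z

    -- `Z` is closed under edges avoiding `v`, so an edge entering `Z` from outside starts at `v`,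
    -- and such edges are cut.
    rest-step : ∀ {x y} → Kept x y → InRest x → InRest y
    rest-step {x} {y} (g-xy , ¬cut) (ρx≡r , x∉Z) = trans (sym (adj-root G g-xy)) ρx≡r , y∉Z
      where
      y∉Z : y ∉ Z
      y∉Z y∈Z with x ≟ v
      ... | yes x≡v = ¬cut (inj₁ (x≡v , y∈Z))
      ... | no x≢v  = x∉Z (closed y∈Z (symmetric G g-xy , Z-≢v y∈Z , x≢v))

    kept-sym : ∀ {x y} → Kept x y → Kept y x
    kept-sym (g-xy , ¬cut) = symmetric G g-xy , [ ¬cut ∘ inj₂ , ¬cut ∘ inj₁ ]′

    -- A path from `x` to `r` meets `v` before it enters `Z`. Up to its first visit to `v` both ends
    -- of each edge lie outside `Z`, so no edge is cut; this stretch is reversed.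
    rest-connected : ∀ {x} → Connected g x r → x ∉ Z → Star Kept v x
    rest-connected ε r∉Z = contradiction start r∉Z
    rest-connected {x} (_◅_ {j = y} g-xy path) x∉Z with x ≟ v
    ... | yes refl = ε
    ... | no x≢v with y ∈? Z
    ...   | yes y∈Z = contradiction (closed y∈Z (symmetric G g-xy , Z-≢v y∈Z , x≢v)) x∉Z
    ...   | no y∉Z  = rest-connected path y∉Z ◅◅ ((symmetric G g-xy , [ x∉Z ∘ proj₂ , y∉Z ∘ proj₂ ]′) ◅ ε)

    -- The edge by which the path first enters `Z` starts at `v`. Applied to `v` itself, this shows
    -- that the set of deleted edges is nonempty.
    neighbour : ∀ {x} → Connected g x r → x ∉ Z → ∃ λ z → z ∈ Z × Adj g v z
    neighbour ε r∉Z = contradiction start r∉Z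
    neighbour {x} (_◅_ {j = y} g-xy path) x∉Z with y ∈? Z
    ... | no y∉Z  = neighbour path y∉Z
    ... | yes y∈Z with x ≟ v
    ...   | yes refl = y , y∈Z , g-xy
    ...   | no x≢v   = contradiction (closed y∈Z (symmetric G g-xy , Z-≢v y∈Z , x≢v)) x∉Z

    to-r : ∀ {x} → ρ x ≡ r → Connected g x r
    to-r {x} ρx≡r = Connected-sym {g = g} (λ {a} {b} → symmetric G {a} {b})
      (subst (λ q → Connected g q x) ρx≡r (connected G x))

    Rooted-detach : Rooted (insertAfter v (A , r , B)) g′ ρ′
    Rooted-detach = record
      { irreflexive = irreflexive G ∘ proj₁ ∘ adj⁻
      ; symmetric   = adj⁺ ∘ kept-sym ∘ adj⁻
      ; root-∈      = root-∈′
      ; root-fixed  = root-fixed′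
      ; connected   = λ x → gmap id adj⁺ (conn x)
      ; adj-root    = adj-root′ ∘ adj⁻
      }
      where
      adj⁺ : ∀ {x y} → Kept x y → Adj g′ x y
      adj⁺ = Adj-graphOf⁺ kept?
      adj⁻ : ∀ {x y} → Adj g′ x y → Kept x y
      adj⁻ = Adj-graphOf⁻ kept?
      root-∈′ : ∀ x → ρ′ x ∈ insertAfter v (A , r , B)
      root-∈′ x with inRest? x
      ... | yes rest = subst (_∈ insertAfter v (A , r , B)) (sym (ρ′-rest rest)) (v-∈-insertAfter v s∈)
      ... | no ¬rest = subst (_∈ insertAfter v (A , r , B)) (sym (ρ′-other ¬rest)) (∈-insertAfter⁺ v s∈ (root-∈ G x))
      root-fixed′ : ∀ {q} → q ∈ insertAfter v (A , r , B) → ρ′ q ≡ q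
      root-fixed′ {q} q∈ with ∈-insertAfter⁻ v s∈ q∈
      ... | inj₁ refl = ρ′-rest rest-v
      -- A root in the component of `r` is `r` itself, which lies in `Z`; hence no old root falls
      -- into the rest.
      ... | inj₂ q∈R  = trans (ρ′-other λ { (ρq≡r , q∉Z) →
        q∉Z (subst (_∈ Z) (trans (sym ρq≡r) (root-fixed G q∈R)) start) }) (root-fixed G q∈R)
      -- Every cut edge ends at `v` and so lies in the component of `r`; paths in other components
      -- keep all their edges.
      avoid : ∀ {x y} → Connected g x y → ρ x ≢ r → Star Kept x y
      avoid ε _ = ε
      avoid (g-xy ◅ path) ρx≢r = (g-xy , [ (λ { (refl , _) → ρx≢r refl }) , (λ { (refl , _) → ρx≢r (adj-root G g-xy) }) ]′)
        ◅ avoid path (ρx≢r ∘ trans (adj-root G g-xy))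
      inside : ∀ {x y} → Star (Avoiding g v) x y → Star Kept x y
      inside = gmap id λ { (g-xy , x≢v , y≢v) → g-xy , [ x≢v ∘ proj₁ , y≢v ∘ proj₁ ]′ }
      conn : ∀ x → Star Kept (ρ′ x) x
      conn x with inRest? x
      ... | yes rest = subst (λ q → Star Kept q x) (sym (ρ′-rest rest)) (rest-connected (to-r (proj₁ rest)) (proj₂ rest))
      ... | no ¬rest = subst (λ q → Star Kept q x) (sym (ρ′-other ¬rest)) (conn′ (ρ x ≟ r) (x ∈? Z))
        where
        conn′ : Dec (ρ x ≡ r) → Dec (x ∈ Z) → Star Kept (ρ x) x
        conn′ (no ρx≢r)  _         = avoid (connected G x) (λ ρρx≡r → ρx≢r (trans (sym (root-fixed G (root-∈ G x))) ρρx≡r))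
        conn′ (yes ρx≡r) (yes x∈Z) = subst (λ q → Star Kept q x) (sym ρx≡r) (inside (reach x∈Z))
        conn′ (yes ρx≡r) (no x∉Z)  = contradiction (ρx≡r , x∉Z) ¬rest
      adj-root′ : ∀ {x y} → Kept x y → ρ′ x ≡ ρ′ y
      adj-root′ {x} {y} kept with inRest? x
      ... | yes rest = trans (ρ′-rest rest) (sym (ρ′-rest (rest-step kept rest)))
      ... | no ¬rest = trans (ρ′-other ¬rest) (trans (adj-root G (proj₁ kept)) (sym (ρ′-other (¬rest ∘ rest-step (kept-sym kept)))))

    class-Z : ∀ {x} → x ∈ Z → ρ′ x ≡ r
    class-Z x∈Z = trans (ρ′-other (λ rest → proj₂ rest x∈Z)) (Z-root x∈Z)

    Z-class : ∀ {x} → ρ′ x ≡ r → x ∈ Z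
    Z-class {x} ρ′x≡r = go (ρ x ≟ r) (x ∈? Z)
      where
      go : Dec (ρ x ≡ r) → Dec (x ∈ Z) → x ∈ Z
      go _          (yes x∈Z) = x∈Z
      go (yes ρx≡r) (no x∉Z)  = contradiction (trans (sym ρ′x≡r) (ρ′-rest (ρx≡r , x∉Z))) r≢v′
      go (no ρx≢r)  (no _)    = contradiction (trans (sym (ρ′-other (ρx≢r ∘ proj₁))) ρ′x≡r) ρx≢r

    -- `σ` stands for the root map returned by the enumeration, which agrees with `ρ′` only
    -- pointwise.
    neighbours : (Fin V → Fin V) → List (Fin V)
    neighbours σ = filter (Adj? g v) (class σ r)

    addStar-detach : ∀ {σ} → (∀ x → σ x ≡ ρ′ x) → addStar v (neighbours σ) g′ ≡ g
    addStar-detach {σ} σ≗ρ′ = Adj-ext (addStar v (neighbours σ) g′) g to from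
      where
      S : List (Fin V)
      S = neighbours σ
      S⇒Adj : ∀ {y} → y ∈ S → Adj g v y
      S⇒Adj y∈ = proj₂ (∈-filter⁻ (Adj? g v) {xs = class σ r} y∈)
      Adj⇒S : ∀ {y} → y ∈ Z → Adj g v y → y ∈ S
      Adj⇒S {y} y∈Z = ∈-filter⁺ (Adj? g v) (∈-class⁺ σ (trans (σ≗ρ′ y) (class-Z y∈Z)))
      to : ∀ {x y} → Adj (addStar v S g′) x y → Adj g x y
      to adj with addStar⁻ v S g′ adj
      ... | inj₁ g′-xy              = proj₁ (Adj-graphOf⁻ kept? g′-xy)
      ... | inj₂ (inj₁ (refl , y∈)) = S⇒Adj y∈
      ... | inj₂ (inj₂ (refl , x∈)) = symmetric G (S⇒Adj x∈)
      from : ∀ {x y} → Adj g x y → Adj (addStar v S g′) x y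
      from {x} {y} g-xy with kept? x y | (x ≟ v ×-dec y ∈? Z) ⊎-dec (y ≟ v ×-dec x ∈? Z)
      ... | yes kept | _                       = addStar⁺ v S g′ (inj₁ (Adj-graphOf⁺ kept? kept))
      ... | no _     | yes (inj₁ (refl , y∈Z)) = addStar⁺ v S g′ (inj₂ (inj₁ (refl , Adj⇒S y∈Z g-xy)))
      ... | no _     | yes (inj₂ (refl , x∈Z)) = addStar⁺ v S g′ (inj₂ (inj₂ (refl , Adj⇒S x∈Z (symmetric G g-xy))))
      ... | no ¬kept | no ¬cut                 = contradiction (g-xy , ¬cut) ¬kept

    neighbours-∈ : ∀ {σ} → (∀ x → σ x ≡ ρ′ x) → neighbours σ ∈ nonemptySubsets (class σ r)
    neighbours-∈ {σ} σ≗ρ′ = let z , z∈Z , g-vz = neighbour (to-r refl) v∉Z in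
      filter-∈-nonemptySubsets (Adj? g v) (lose (∈-class⁺ σ (trans (σ≗ρ′ z) (class-Z z∈Z))) g-vz)

  -- `Detach` makes `v` a root, the smaller graph is found by induction, and `v` is reattached to
  -- its former neighbours in `Z`. The induction hypothesis gives back only the graph; `root-unique`
  -- supplies its root map. When `U` is empty every vertex is its own root, so an edge would be a
  -- loop.
  rootedGraphs-complete : ∀ {R} U {g ρ} → Layout R U → Rooted R g ρ → ∃ λ e → e ∈ rootedGraphs R U × graph e ≡ g
  rootedGraphs-complete []      {g} L G = _ , here refl , Adj-ext edgeless g
    (λ {x} {y} adj → ⊥-elim (Adj-edgeless {x = x} {y} adj))
    λ {x} {y} g-xy → ⊥-elim (irreflexive G (subst (λ z → Adj g z y) (same g-xy) g-xy))
    where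
    fixed : ∀ z → _
    fixed z = root-fixed G ([ id , (λ ()) ]′ (cover L z))
    same : ∀ {x y} → Adj g x y → x ≡ y
    same {x} {y} g-xy = trans (sym (fixed x)) (trans (adj-root G g-xy) (fixed y))
  rootedGraphs-complete {R} (v ∷ U) {g} {ρ} L G with A , B , s∈ ← ∈-splits⁺ (root-∈ G v) =
    extend (reachable (avoiding? g v) (ρ v))
    where
    extend : Reachable (Avoiding g v) (ρ v) → ∃ λ e → e ∈ rootedGraphs R (v ∷ U) × graph e ≡ g
    extend C = attach v (ρ v) e (neighbours (rootOf e)) ,
      ∈-concatMap⁺ _ (lose s∈ (∈-concatMap⁺ (attachments v (ρ v))
        (lose e∈ (∈-map⁺ (attach v (ρ v) e) (neighbours-∈ same-root))))) ,
      trans (cong (addStar v (neighbours (rootOf e))) eq) (addStar-detach same-root)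
      where
      open Detach L G s∈ C
      rest : ∃ λ e → e ∈ rootedGraphs (insertAfter v (A , ρ v , B)) U × graph e ≡ g′
      rest = rootedGraphs-complete U (Layout-insertAfter v s∈ L) Rooted-detach
      e = proj₁ rest
      e∈ = proj₁ (proj₂ rest)
      eq = proj₂ (proj₂ rest)
      same-root : ∀ x → rootOf e x ≡ ρ′ x
      same-root = root-unique (proj₁ (rootedGraphs-sound (Layout-insertAfter v s∈ L) e∈))
                              (subst (λ h → Rooted _ h ρ′) (sym eq) Rooted-detach)

  -- Component sizes and the weighted count.

  module _ {v r : Fin V} (r≢v : r ≢ v) (ρ : Fin V → Fin V) where

    private
      σ : Fin V → Fin V
      σ = relabel v r ρ

    relabel-elim : ∀ {x q} → σ x ≡ q → (ρ x ≡ v × r ≡ q) ⊎ (ρ x ≢ v × ρ x ≡ q)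
    relabel-elim {x} eq with ρ x ≟ v
    ... | yes ρx≡v = inj₁ (ρx≡v , eq)
    ... | no ρx≢v  = inj₂ (ρx≢v , eq)

    length-class-relabel : length (class σ r) ≡ length (class ρ r) + length (class ρ v)
    length-class-relabel = length-filter-⊎ (λ x → ρ x ≟ r) (λ x → ρ x ≟ v) (λ x → σ x ≟ r)
      (λ eq → [ inj₂ ∘ proj₁ , inj₁ ∘ proj₂ ]′ (relabel-elim eq))
      (λ ρx≡r → trans (relabel-≢ ρ (r≢v ∘ trans (sym ρx≡r))) ρx≡r)
      (relabel-≡ ρ)
      (λ ρx≡r ρx≡v → r≢v (trans (sym ρx≡r) ρx≡v))
      (allFin V)

    class-relabel : ∀ {q} → q ≢ r × q ≢ v → class σ q ≡ class ρ q
    class-relabel {q} (q≢r , q≢v) = filter-≐ (λ x → σ x ≟ q) (λ x → ρ x ≟ q)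
      ( (λ eq → [ (λ { (_ , r≡q) → contradiction (sym r≡q) q≢r }) , proj₂ ]′ (relabel-elim eq))
      , (λ ρx≡q → trans (relabel-≢ ρ (q≢v ∘ trans (sym ρx≡q))) ρx≡q))
      (allFin V)

    -- The class of `r` absorbs that of `v`, the next root in the list, and all other roots keep
    -- their classes.
    sizes-relabel : ∀ {A B} → All (λ q → q ≢ r × q ≢ v) A → All (λ q → q ≢ r × q ≢ v) B →
                    sizes (A ++ r ∷ B) σ ≡ mergeAt (length A) (sizes (A ++ r ∷ v ∷ B) ρ)
    sizes-relabel []         others = cong₂ _∷_ length-class-relabel
      (map-cong-local (All.map (cong length ∘ class-relabel) others))
    sizes-relabel (q≢ ∷ as)  others = cong₂ _∷_ (cong length (class-relabel q≢)) (sizes-relabel as others)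

  sizeAt-pivot : ∀ A {r B} (ρ : Fin V → Fin V) → sizeAt (length A) (sizes (A ++ r ∷ B) ρ) ≡ length (class ρ r)
  sizeAt-pivot []      ρ = refl
  sizeAt-pivot (_ ∷ A) ρ = sizeAt-pivot A ρ

  sizes-id : ∀ (R : List (Fin V)) → sizes R id ≡ replicate (length R) 1
  sizes-id []      = refl
  sizes-id (r ∷ R) = cong₂ _∷_ (length-filter-≟ (Unique.allFin⁺ V) (∈-allFin r)) (sizes-id R)

  other-roots : ∀ {R U v A r B} → Layout R (v ∷ U) → (A , r , B) ∈ splits R →
                ∀ {q} → q ∈ A ++ B → q ≢ r × q ≢ v
  other-roots {R} {v = v} {A} {r} {B} L s∈ q∈ with R↭ ← ↭-trans (↭-reflexive (∈-splits⁻ R s∈)) (shift r A B)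
    with r≢ ∷ _ ← Permutation.Unique-resp-↭ (setoid (Fin V)) (↭⇒↭ₛ R↭) (unique L)
    = All.lookup r≢ q∈ ∘ sym , λ { refl → v∉R L s∈ (∈-resp-↭ (↭-sym R↭) (there q∈)) }

  -- The contribution of all ways to attach a vertex to the i-th component.
  attachWeight : Weight → ℕ → Weight
  attachWeight ψ i c k = ∑ (downFrom (sizeAt i c)) (λ a → binomial a (λ l → ψ (mergeAt i c) (k + l)))

  parkOne-binomial : ∀ t ψ c d → ∑ (upTo t) (λ i → binomial d (attachWeight ψ i c)) ≡
                                 parkOne t (λ c′ d′ → binomial d′ (ψ c′)) c d
  parkOne-binomial t ψ c d = ∑-cong (upTo t) λ i →
    trans (binomial-∑ d (downFrom (sizeAt i c)) _)
          (∑-cong (downFrom (sizeAt i c)) λ a → sym (binomial-+ d a (ψ (mergeAt i c))))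

  -- Summing over the attached sets turns the removed vertex into the weight `attachWeight`, to
  -- which the induction hypothesis applies. Vandermonde then combines its binomial with that of the
  -- smaller graph, and `park-last` reads the result as the last car.
  rootedGraphs-count : ∀ U {R} → Layout R U → (ψ : Weight) →
    ∑ (rootedGraphs R U) (λ e → ψ (sizes R (rootOf e)) (excess e)) ≡
    park (length U) (length R) (λ c d → binomial d (ψ c)) (replicate (length U + length R) 1) 0
  rootedGraphs-count []      {R} L ψ = trans (+-identityʳ _) (cong (λ c → ψ c 0) (sizes-id R))
  rootedGraphs-count (v ∷ U) {R} L ψ = begin
    ∑ (rootedGraphs R (v ∷ U)) weight
      ≡⟨ ∑-concatMap (λ s → concatMap (attachments v (pivot s)) (rootedGraphs (insertAfter v s) U)) (splits R) weight ⟩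
    ∑ (splits R) (λ s → ∑ (concatMap (attachments v (pivot s)) (rootedGraphs (insertAfter v s) U)) weight)
      ≡⟨ ∑-cong-∈ (splits R) per-split ⟩
    ∑ (splits R) (λ (A , _) → parked (length A))
      ≡⟨ ∑-splits R parked ⟩
    ∑ (upTo t) parked
      ≡⟨ park-∑ m (suc t) (upTo t) (λ i c d → binomial d (attachWeight ψ i c)) (replicate (m + suc t) 1) 0 ⟩
    park m (suc t) (λ c d → ∑ (upTo t) (λ i → binomial d (attachWeight ψ i c))) (replicate (m + suc t) 1) 0
      ≡⟨ park-cong m (suc t) (parkOne-binomial t ψ) (replicate (m + suc t) 1) 0 ⟩
    park m (suc t) (parkOne t (λ c d → binomial d (ψ c))) (replicate (m + suc t) 1) 0
      ≡⟨ cong-app (cong-app (park-last m t (λ c d → binomial d (ψ c))) (replicate (m + suc t) 1)) 0 ⟩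
    park (suc m) t (λ c d → binomial d (ψ c)) (replicate (m + suc t) 1) 0
      ≡⟨ cong (λ n → park (suc m) t (λ c d → binomial d (ψ c)) (replicate n 1) 0) (+-suc m t) ⟩
    park (suc m) t (λ c d → binomial d (ψ c)) (replicate (suc m + t) 1) 0 ∎
    where
    m t : ℕ
    m = length U
    t = length R
    weight : RootedGraph → ℕ
    weight e = ψ (sizes R (rootOf e)) (excess e)
    parked : ℕ → ℕ
    parked i = park m (suc t) (λ c d → binomial d (attachWeight ψ i c)) (replicate (m + suc t) 1) 0
    module _ {A r B} (s∈ : (A , r , B) ∈ splits R) where
      R′ : List (Fin V)
      R′ = insertAfter v (A , r , B)
      sizes-attach : ∀ ρ → sizes R (relabel v r ρ) ≡ mergeAt (length A) (sizes R′ ρ)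
      sizes-attach ρ = trans (cong (λ Q → sizes Q (relabel v r ρ)) (∈-splits⁻ R s∈))
        (sizes-relabel (r≢v L s∈) ρ (All.tabulate (other-roots L s∈ ∘ ∈-++⁺ˡ)) (All.tabulate (other-roots L s∈ ∘ ∈-++⁺ʳ A)))
      per-graph : ∀ e → ∑ (attachments v r e) weight ≡ attachWeight ψ (length A) (sizes R′ (rootOf e)) (excess e)
      per-graph e = begin
        ∑ (attachments v r e) weight
          ≡⟨ ∑-map (attach v r e) (nonemptySubsets (class (rootOf e) r)) weight ⟩
        ∑ (nonemptySubsets (class (rootOf e) r)) (λ S → ψ (sizes R (relabel v r (rootOf e))) (excess e + pred (length S)))
          ≡⟨ ∑-nonemptySubsets (class (rootOf e) r) (λ l → ψ (sizes R (relabel v r (rootOf e))) (excess e + l)) ⟩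
        ∑ (downFrom (length (class (rootOf e) r))) (λ a → binomial a (λ l → ψ (sizes R (relabel v r (rootOf e))) (excess e + l)))
          ≡⟨ cong₂ (λ n c → ∑ (downFrom n) (λ a → binomial a (λ l → ψ c (excess e + l))))
               (sym (sizeAt-pivot A (rootOf e))) (sizes-attach (rootOf e)) ⟩
        attachWeight ψ (length A) (sizes R′ (rootOf e)) (excess e) ∎
    per-split : ∀ {s} → s ∈ splits R →
                ∑ (concatMap (attachments v (pivot s)) (rootedGraphs (insertAfter v s) U)) weight ≡ parked (length (proj₁ s))
    per-split {A , r , B} s∈ = begin
      ∑ (concatMap (attachments v r) (rootedGraphs (R′ s∈) U)) weight
        ≡⟨ ∑-concatMap (attachments v r) (rootedGraphs (R′ s∈) U) weight ⟩
      ∑ (rootedGraphs (R′ s∈) U) (λ e → ∑ (attachments v r e) weight)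
        ≡⟨ ∑-cong (rootedGraphs (R′ s∈) U) (per-graph s∈) ⟩
      ∑ (rootedGraphs (R′ s∈) U) (λ e → attachWeight ψ (length A) (sizes (R′ s∈) (rootOf e)) (excess e))
        ≡⟨ rootedGraphs-count U (Layout-insertAfter v s∈ L) (attachWeight ψ (length A)) ⟩
      park m (length (R′ s∈)) (λ c d → binomial d (attachWeight ψ (length A) c)) (replicate (m + length (R′ s∈)) 1) 0
        ≡⟨ cong (λ l → park m l (λ c d → binomial d (attachWeight ψ (length A) c)) (replicate (m + l) 1) 0)
             (length-insertAfter v s∈) ⟩
      parked (length A) ∎

-- The decision `f x ≟ℕ k` computes through `f x ≡ᵇ k`, so one case split evaluates both sides.
length-filter-indicator : ∀ (xs : List A) (f : A → ℕ) k →
                          length (filter (λ x → f x ≟ℕ k) xs) ≡ ∑ xs (indicator k ∘ f)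
length-filter-indicator []       f k = refl
length-filter-indicator (x ∷ xs) f k with f x ≡ᵇ k
... | true  = cong suc (length-filter-indicator xs f k)
... | false = length-filter-indicator xs f k

-- The specified vertices as roots.

module _ (s m : ℕ) where

  roots nonroots : List (Fin (s + m))
  roots    = map (_↑ˡ m) (allFin s)
  nonroots = map (s ↑ʳ_) (allFin m)

  initial-layout : Layout roots nonroots
  initial-layout = record
    { unique   = Unique.map⁺ (↑ˡ-injective m _ _) (Unique.allFin⁺ s)
    ; unique′  = Unique.map⁺ (↑ʳ-injective s _ _) (Unique.allFin⁺ m)
    ; disjoint = disj
    ; cover    = cov
    }
    where
    disj : ∀ {x} → x ∈ roots → x ∉ nonroots
    disj x∈ x∈′ with a , _ , refl ← ∈-map⁻ (_↑ˡ m) x∈ | b , _ , eq ← ∈-map⁻ (s ↑ʳ_) x∈′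
      with () ← trans (sym (splitAt-↑ˡ s a m)) (trans (cong (splitAt s) eq) (splitAt-↑ʳ s m b))
    cov : ∀ x → x ∈ roots ⊎ x ∈ nonroots
    cov x with splitAt s x in eq
    ... | inj₁ a = inj₁ (subst (_∈ roots) (splitAt⁻¹-↑ˡ eq) (∈-map⁺ (_↑ˡ m) (∈-allFin a)))
    ... | inj₂ b = inj₂ (subst (_∈ nonroots) (splitAt⁻¹-↑ʳ eq) (∈-map⁺ (s ↑ʳ_) (∈-allFin b)))

  length-roots : length roots ≡ s
  length-roots = trans (length-map (_↑ˡ m) (allFin s)) (length-tabulate id)

  length-nonroots : length nonroots ≡ m
  length-nonroots = trans (length-map (s ↑ʳ_) (allFin m)) (length-tabulate id)

  root-∈-roots : ∀ a → root a ∈ roots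
  root-∈-roots a = ∈-map⁺ (_↑ˡ m) (∈-allFin a)

  Rooted⇒Simple : ∀ {g ρ} → Rooted roots g ρ → IsSimple g
  Rooted⇒Simple G = (λ i → Bool.¬-not (Rooted.irreflexive G)) ,
                    (λ i j → bool-ext (Rooted.symmetric G) (Rooted.symmetric G))

  Rooted⇒ComponentCondition : ∀ {g ρ} → Rooted roots g ρ → ComponentCondition s m g
  Rooted⇒ComponentCondition {g} {ρ} G =
    (λ a b conn → ↑ˡ-injective m a b (trans (sym (Rooted.root-fixed G (root-∈-roots a)))
                    (trans (connected-root G conn) (Rooted.root-fixed G (root-∈-roots b))))) ,
    λ v → let a , _ , eq = ∈-map⁻ (_↑ˡ m) (Rooted.root-∈ G v) in
      a , subst (λ r → Connected g r v) eq (Rooted.connected G v)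

  -- The witnesses in the second half of the condition serve as the root map; the first half makes
  -- it constant along edges and the identity on roots.
  Simple⇒Rooted : ∀ {g} → IsSimple g → (cond : ComponentCondition s m g) →
                  Rooted roots g (λ v → root (proj₁ (proj₂ cond v)))
  Simple⇒Rooted {g} (irr , symm) (separate , reach) = record
    { irreflexive = λ {x} adj → contradiction (trans (sym adj) (irr x)) λ ()
    ; symmetric   = sym-g
    ; root-∈      = λ x → root-∈-roots (proj₁ (reach x))
    ; root-fixed  = fixed
    ; connected   = λ x → proj₂ (reach x)
    ; adj-root    = λ {x} {y} adj → cong root (separate _ _
        (proj₂ (reach x) ◅◅ (adj ◅ Connected-sym {g = g} sym-g (proj₂ (reach y)))))
    }
    where
    sym-g : ∀ {x y} → Adj g x y → Adj g y x
    sym-g {x} {y} adj = trans (symm y x) adj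
    fixed : ∀ {r} → r ∈ roots → root (proj₁ (reach r)) ≡ r
    fixed r∈ with a , _ , refl ← ∈-map⁻ (_↑ˡ m) r∈ = cong root (separate _ a (proj₂ (reach (root a))))

theorem2p9 : (s m k : ℕ) → s ≥ 1 →
    NumberOf (λ (g : Graph (s + m)) →
    IsSimple g × edgeCount g ≡ m + k × ComponentCondition s m g)
    (pfBinomSum m (m + s ∸ 1) k)
theorem2p9 s@(suc t) m k _ = map graph selected , distinct , (λ g → mk⇔ to from) , count
  where
  open RootedGraph
  layout : Layout (roots s m) (nonroots s m)
  layout = initial-layout s m
  all-graphs selected : List RootedGraph
  all-graphs = rootedGraphs (roots s m) (nonroots s m)
  selected   = filter (λ e → excess e ≟ℕ k) all-graphs
  distinct : Unique (map graph selected)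
  distinct = AllPairs.map⁺ (AllPairs.filter⁺ (λ e → excess e ≟ℕ k) (rootedGraphs-distinct layout))
  edges : ∀ {e} → e ∈ all-graphs → edgeCount (graph e) ≡ m + excess e
  edges e∈ = trans (proj₂ (rootedGraphs-sound layout e∈)) (cong (_+ _) (length-nonroots s m))
  to : ∀ {g} → g ∈ map graph selected → IsSimple g × edgeCount g ≡ m + k × ComponentCondition s m g
  to g∈ with e , e∈ , refl ← ∈-map⁻ graph g∈
    with e∈′ , excess≡k ← ∈-filter⁻ (λ e → excess e ≟ℕ k) {xs = all-graphs} e∈
    with G , _ ← rootedGraphs-sound layout e∈′
    = Rooted⇒Simple s m G , trans (edges e∈′) (cong (m +_) excess≡k) , Rooted⇒ComponentCondition s m G
  from : ∀ {g} → IsSimple g × edgeCount g ≡ m + k × ComponentCondition s m g → g ∈ map graph selected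
  from {g} (simple , edges≡ , cond)
    with e , e∈ , eq ← rootedGraphs-complete (nonroots s m) {g} layout (Simple⇒Rooted s m {g} simple cond)
    = subst (_∈ map graph selected) eq (∈-map⁺ graph (∈-filter⁺ (λ e → excess e ≟ℕ k) e∈
        (+-cancelˡ-≡ m _ _ (trans (sym (edges e∈)) (trans (cong edgeCount eq) edges≡)))))
  count : length (map graph selected) ≡ pfBinomSum m (m + s ∸ 1) k
  count = begin
    length (map graph selected)                  ≡⟨ length-map graph selected ⟩
    length selected                              ≡⟨ length-filter-indicator all-graphs excess k ⟩
    -- The weight ignores the sizes here; they enter only inside the induction.
    ∑ all-graphs (indicator k ∘ excess)          ≡⟨ rootedGraphs-count (nonroots s m) layout (λ _ → indicator k) ⟩
    park (length (nonroots s m)) (length (roots s m)) (λ _ d → binomial d (indicator k))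
         (replicate (length (nonroots s m) + length (roots s m)) 1) 0
      ≡⟨ cong₂ (λ a b → park a b (λ _ d → binomial d (indicator k)) (replicate (a + b) 1) 0)
           (length-nonroots s m) (length-roots s m) ⟩
    park m s (λ _ d → binomial d (indicator k)) (replicate (m + s) 1) 0
      ≡⟨ park-cong m s (λ _ d → binomial-indicator d k) (replicate (m + s) 1) 0 ⟩
    park m s (λ _ d → d C k) (replicate (m + s) 1) 0
      -- With `s = suc t` the street has m + t spots, of which t stay empty, leaving s runs.
      ≡⟨ pfBinomSum-park m t k ⟨
    pfBinomSum m (m + t) k
      ≡⟨ cong (λ n → pfBinomSum m (n ∸ 1) k) (+-suc m t) ⟨
    pfBinomSum m (m + s ∸ 1) k ∎
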